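{- Let $p$ be an odd prime and $k\in\mathbb{N}$ with $2\le k\le\frac{p-1}{2}$ such that $p\equiv 1\pmod{2k}$. Let $\alpha_1,\ldots,\alpha_{(p-1)/k}$ be the distinct $k$-th power residues modulo $p$ and let $T\left(\frac{p-1}{k}\right)=\prod_{1\le i<j\le\frac{p-1}{k}}(\alpha_i-\alpha_j)$. (a) If $p\equiv 1\pmod{4k}$, then $$\left(\frac{\sqrt{S_{1+\frac{p-1}{k},k}(-1,p)}}{p}\right)=\left(\frac{(k-1)(2k-1)}{p}\right)\left(\frac{\frac{p-1}{k}!!}{p}\right)\left(\frac{T\left(\frac{p-1}{k}\right)}{p}\right).$$ (b) If $k$ is even and $p\equiv 2k+1\pmod{4k}$, then $$\left(\frac{\sqrt{S_{1+\frac{p-1}{k},k}(-1,p)}}{p}\right)=\begin{cases}\left(\frac{T\left(\frac{p-1}{k}\right)}{p}\right), & \text{if } p=2k+1;\\[4pt] \left(\frac{k(2k-1)}{p}\right)\left(\frac{\left(\frac{p-1}{k}-1\right)!!}{p}\right)\left(\frac{T\left(\frac{p-1}{k}\right)}{p}\right), & \text{otherwise.}\end{cases}$$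
   Context: For an odd prime $p$ and an integer $k\ge 2$ with $k\mid p-1$, the $\alpha_i$ $(1\le i\le\frac{p-1}{k})$ are integers representing the distinct (nonzero) $k$-th power residues modulo $p$, and for $n\in\mathbb{N}$, $d\in\mathbb{Z}$, $$S_{n,k}(d,p)=\det\left[(\alpha_i+d\,\alpha_j)^n\right]_{1\le i,j\le \frac{p-1}{k}}.$$ When $p\equiv 1\pmod{2k}$ and $n$ is odd, $S_{n,k}(-1,p)$ is the determinant of a skew-symmetric integer matrix of even order, hence the square of an integer, and $\sqrt{S_{n,k}(-1,p)}$ denotes its integer square root (the sign is immaterial inside the Legendre symbol when $p\equiv 1\pmod 4$, which is so in all the cases considered). $\left(\frac{\cdot}{p}\right)$ is the Legendre symbol. For $a\in\mathbb{N}$, $a!!$ is the double factorial: $a!!=a\cdot(a-2)!!$ if $a>2$ and $a!!=a$ if $a\in\{1,2\}$; $\frac{p-1}{k}!!$ means $\left(\frac{p-1}{k}\right)!!$. -}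

module Defs where

open import Algebra.Properties.CommutativeMonoid.Sum using (sum)
open import Data.Bool using (if_then_else_)
open import Data.Fin using (Fin; zero; suc; toℕ; punchIn; _<?_)
open import Data.Fin.Properties using (any?)
open import Data.Integer using (ℤ; +_; 0ℤ; 1ℤ; -1ℤ; _+_; _-_; _*_; _^_)
open import Data.Integer.Divisibility.Signed using (_∣_; _∣?_)
open import Data.Integer.Properties using (+-0-commutativeMonoid; *-1-commutativeMonoid)
open import Data.Nat as ℕ using (ℕ; zero; suc)
open import Data.Product using (∃; _×_)
open import Relation.Binary.PropositionalEquality using (_≡_)
open import Relation.Nullary using (¬_; Dec; does)

infix 4 _≡_[mod_] _≡?_[mod_]

_≡_[mod_] : ℤ → ℤ → ℕ → Set
a ≡ b [mod n ] = + n ∣ a - b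

_≡?_[mod_] : ∀ a b n → Dec (a ≡ b [mod n ])
a ≡? b [mod n ] = + n ∣? a - b

∑ ∏ : ∀ {n} → (Fin n → ℤ) → ℤ
∑ = sum +-0-commutativeMonoid
∏ = sum *-1-commutativeMonoid

Matrix : ℕ → Set
Matrix n = Fin n → Fin n → ℤ

-- Laplace expansion along the first row.
det : ∀ {n} → Matrix n → ℤ
det {zero}  A = 1ℤ
det {suc n} A =
  ∑ λ j → -1ℤ ^ toℕ j * A zero j * det (λ r c → A (suc r) (punchIn j c))

infix 9 _!!

-- The value at 0 is only a base case, chosen so that 2 !! = 2.
_!! : ℕ → ℕ
zero !!        = 1
suc zero !!    = 1
suc (suc n) !! = suc (suc n) ℕ.* n !!

-- The Legendre symbol for an odd prime p. A square root of a modulo p is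
-- searched for among 0, …, p - 1, which represent all classes modulo p.
legendre : ℤ → ℕ → ℤ
legendre a p =
  if does (a ≡? 0ℤ [mod p ]) then 0ℤ
  else if does (any? λ (x : Fin p) → (+ toℕ x) ^ 2 ≡? a [mod p ]) then 1ℤ
  else -1ℤ

IsPowerResidue : (k p : ℕ) → ℤ → Set
IsPowerResidue k p a = ¬ (a ≡ 0ℤ [mod p ]) × ∃ λ x → x ^ k ≡ a [mod p ]

-- α lists, in some order, one integer from each class of nonzero k-th power
-- residues modulo p. The integers need not lie between 0 and p.
record RepresentsPowerResidues (k p : ℕ) {m : ℕ} (α : Fin m → ℤ) : Set where
  field
    residue  : ∀ i → IsPowerResidue k p (α i)
    distinct : ∀ i j → α i ≡ α j [mod p ] → i ≡ j
    complete : ∀ a → IsPowerResidue k p a → ∃ λ i → α i ≡ a [mod p ]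

S : ∀ {m} → ℕ → ℤ → (Fin m → ℤ) → ℤ
S n d α = det λ i j → (α i + d * α j) ^ n

T : ∀ {m} → (Fin m → ℤ) → ℤ
T α = ∏ λ i → ∏ λ j → if does (i <? j) then α i - α j else 1ℤ

-- s is an integer square root of a, of either sign.
IsSqrt : ℤ → ℤ → Set
IsSqrt s a = s ^ 2 ≡ a

{-# OPTIONS --safe #-}

-- Write m = (p - 1) / k. Since α^m ≡ 1 modulo p for every k-th power residue α, and m is
-- even, the binomial theorem turns the entry (αᵢ - αⱼ)^(m+1) into a bilinear form in the
-- powers αᵢ^r and αⱼ^t with r, t < m, whose coefficient matrix C is monomial and
-- skew-symmetric. Hence the determinant is det(V) det(C) det(Vᵀ) for the Vandermonde matrix
-- V, and det(C) is the square of the Pfaffian P = (m + 2) ∏_{2 ≤ r ≤ m/2} binom(m + 1, r), so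
-- the square root is congruent to ± T P. As p ≡ 1 modulo 4, the sign does not matter. The
-- Legendre symbol of P is found by writing the binomials in factorials and using
-- k (m + 2) ≡ 2k - 1 and k (m + 1) ≡ k - 1.
module Submission where

open import Data.Fin using (Fin)
open import Data.Integer using (ℤ; +_; 1ℤ; -1ℤ; _+_; _-_; _*_)
open import Data.Nat as ℕ using (ℕ; suc; NonZero; _∸_; _/_; _≤_)
open import Data.Nat.Divisibility using (_∣_)
open import Data.Nat.Primality using (Prime)
open import Data.Product using (_×_)
open import Relation.Binary.PropositionalEquality using (_≡_; _≢_)
open import Relation.Nullary using (¬_)
open import Defs

open import Algebra.Bundles using (CommutativeRing; Semiring)
import Algebra.Definitions.RawMonoid as RawMonoid
import Algebra.Properties.CommutativeMonoid.Sum as CommutativeMonoidSum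
import Algebra.Properties.CommutativeSemiring.Binomial as Binomial
import Algebra.Properties.Semiring.Sum as SemiringSum
open import Data.Bool using (if_then_else_)
open import Data.Empty using (⊥; ⊥-elim)
open import Data.Fin using
  (zero; suc; toℕ; punchIn; inject₁; fromℕ; fromℕ<; opposite; splitAt; join; _<?_)
open import Data.Fin.Properties using
  (_≟_; suc-injective; toℕ-inject₁; toℕ-fromℕ; toℕ-fromℕ<; toℕ<n; toℕ-injective;
   any?; ¬∀⟶∃¬; pigeonhole; join-splitAt; opposite-prop; <⇒≢)
open import Data.Integer as ℤ using (0ℤ; -_; _^_)
open import Data.Integer.DivMod using (_%ℕ_; _/ℕ_; n%ℕd<d; a≡a%ℕn+[a/ℕn]*n)
import Data.Integer.Divisibility.Signed as ℤ∣
open import Data.Integer.Properties as ℤP using (*-1-commutativeMonoid; +-*-commutativeRing)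
open import Data.Integer.Tactic.RingSolver using (solve-∀)
open import Data.Nat using (zero; _!; z≤n; s≤s)
open import Data.Nat.Combinatorics using
  (_C_; nCk≡n!/k![n-k]!; k![n∸k]!∣n!; nCn≡1; nC1≡n; nCk≡nC[n∸k])
import Data.Nat.Divisibility as ℕ∣
open import Data.Nat.DivMod using (m/n*n≡m; m*n/n≡m)
open import Data.Nat.Primality using (euclidsLemma; prime⇒nonZero; prime⇒nonTrivial)
import Data.Nat.Properties as ℕP
import Data.Nat.Tactic.RingSolver as ℕSolver
open import Data.Product using (∃; _,_; proj₁; proj₂)
open import Data.Sum as Sum using (_⊎_; inj₁; inj₂; [_,_]′)
open import Data.Vec.Functional using (_∷_; tail; updateAt; insertAt; removeAt)
open import Data.Vec.Functional.Properties using (updateAt-updates; updateAt-minimal)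
open import Function using (_∘_; flip)
open import Relation.Binary.Bundles using (Setoid)
open import Relation.Binary.PropositionalEquality using
  (refl; sym; trans; cong; cong₂; cong-app; subst; subst₂; _≗_; module ≡-Reasoning)
import Relation.Binary.Reasoning.Setoid as SetoidReasoning
open import Relation.Nullary using (Dec; yes; no; does)
open import Relation.Nullary.Decidable using (map′; dec-true; dec-false)

-- The integer `s` is known only through `s ^ 2` modulo p, hence only up to sign, so -1 has to be
-- shown to be a square. The residues themselves provide this: if α^(m/2) ≡ 1 held for all m of
-- them, two rows of the transposed Vandermonde matrix would agree modulo p and `T α` would vanish.
-- So some α = x^k satisfies x^(k m/2) ≡ -1, and k m/2 = (p - 1)/2 is even because m/2 is even in
-- (a) and k is even in (b). The parity of m/2 also separates the two formulas. In the symbol of P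
-- each binom(m + 1, r) counts as (m + 1)! r! (m + 1 - r)!, so (m + 1)! occurs m/2 - 1 times: an odd
-- number in (a), an even one in (b). The other factorials are 2!, ..., (m - 1)!, once each, and
-- neighbours combine to leave (m - 1)!!. In (a) this meets (m + 1)! = (m + 1) m!! (m - 1)!!, and (m
-- + 1) m!! survives. As `det` is a Laplace expansion, its product rule is derived from the
-- uniqueness of alternating forms, not from permutations.

module ΣP = SemiringSum (CommutativeRing.semiring +-*-commutativeRing)
module ΠP = CommutativeMonoidSum *-1-commutativeMonoid

module _ where
  open ≡-Reasoning

  ∑-cong : ∀ {n} {f g : Fin n → ℤ} → f ≗ g → ∑ f ≡ ∑ g
  ∑-cong = ΣP.sum-cong-≗

  ∑-zero : ∀ {n} {f : Fin n → ℤ} → (∀ i → f i ≡ 0ℤ) → ∑ f ≡ 0ℤ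
  ∑-zero {n} f≡0 = trans (∑-cong f≡0) (ΣP.sum-replicate-zero n)

  ∑-linear : ∀ {n} x (f g : Fin n → ℤ) {h : Fin n → ℤ} → (∀ i → h i ≡ x * f i + g i) →
             ∑ h ≡ x * ∑ f + ∑ g
  ∑-linear x f g {h} eq = begin
    ∑ h                             ≡⟨ ∑-cong eq ⟩
    ∑ (λ i → x * f i + g i)         ≡⟨ ΣP.∑-distrib-+ (λ i → x * f i) g ⟩
    ∑ (λ i → x * f i) + ∑ g         ≡⟨ cong (_+ ∑ g) (ΣP.*-distribˡ-sum x f) ⟨
    x * ∑ f + ∑ g                   ∎

  -- Alternating multilinear functions of the rows of a matrix

  Rows : ℕ → ℕ → Set
  Rows n m = Fin n → Fin m → ℤ

  infix 4 _≈_
  _≈_ : ∀ {n m} → Rows n m → Rows n m → Set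
  A ≈ B = ∀ i → A i ≗ B i

  -- `linear` compares three matrices whose other rows agree pointwise, so it applies to rows given
  -- by different expressions without function extensionality.
  record Multilinear {n m} (F : Rows n m → ℤ) : Set where
    field
      cong-rows : ∀ {A B} → A ≈ B → F A ≡ F B
      linear    : ∀ i {A B D} x → (∀ r → r ≢ i → A r ≗ D r) → (∀ r → r ≢ i → B r ≗ D r) →
                  (∀ c → D i c ≡ x * A i c + B i c) → F D ≡ x * F A + F B

    -- Linearity with all three matrices equal and `x = -1ℤ` reads `F A ≡ -1ℤ * F A + F A`.
    zero-row : ∀ A i → (∀ c → A i c ≡ 0ℤ) → F A ≡ 0ℤ
    zero-row A i Aᵢ≡0 = trans
      (linear i -1ℤ (λ _ _ _ → refl) (λ _ _ _ → refl)
        (λ c → trans (Aᵢ≡0 c) (sym (cong (λ z → -1ℤ * z + z) (Aᵢ≡0 c)))))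
      (cancel (F A))
      where
      cancel : ∀ x → -1ℤ * x + x ≡ 0ℤ
      cancel = solve-∀

  record Alternating {n m} (F : Rows n m → ℤ) : Set where
    field
      multilinear : Multilinear F
      alternating : ∀ {A} i j → i ≢ j → A i ≗ A j → F A ≡ 0ℤ

    open Multilinear multilinear public

    -- Polarisation: `F` vanishes when rows `i` and `j` both equal `a+b`, and of the four terms of
    -- the expansion the two with a repeated row vanish as well. `M u v` carries `u` in row `i` and
    -- `v` in row `j`.
    swap-rows : ∀ {A B} i j → i ≢ j → (∀ r → r ≢ i → r ≢ j → A r ≗ B r) →
                A i ≗ B j → A j ≗ B i → F A ≡ - F B
    swap-rows {A} {B} i j i≢j A≗B Aᵢ≗Bⱼ Aⱼ≗Bᵢ = negate (begin
      F A + F B                 ≡⟨ cong₂ _+_ (cong-rows A≈) (cong-rows B≈) ⟩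
      F (M a b) + F (M b a)     ≡⟨ pad (F (M a b)) (F (M b a)) ⟩
      1ℤ * (1ℤ * 0ℤ + F (M a b)) + (1ℤ * F (M b a) + 0ℤ)
        ≡⟨ cong₂ (λ x y → 1ℤ * (1ℤ * x + F (M a b)) + (1ℤ * F (M b a) + y)) (M-diag a) (M-diag b) ⟨
      1ℤ * (1ℤ * F (M a a) + F (M a b)) + (1ℤ * F (M b a) + F (M b b))
        ≡⟨ cong₂ (λ x y → 1ℤ * x + y) (linear-j a) (linear-j b) ⟨
      1ℤ * F (M a a+b) + F (M b a+b) ≡⟨ linear-i ⟨
      F (M a+b a+b)             ≡⟨ M-diag a+b ⟩
      0ℤ                        ∎)
      where
      a = A i
      b = A j
      a+b = λ c → 1ℤ * a c + b c
      j≢i = i≢j ∘ sym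
      M : (u v : _ → ℤ) → Rows _ _
      M u v = updateAt (updateAt A i (λ _ → u)) j (λ _ → v)
      Mⱼ : ∀ u v → M u v j ≡ v
      Mⱼ u v = updateAt-updates j _
      Mᵢ : ∀ u v → M u v i ≡ u
      Mᵢ u v = trans (updateAt-minimal i j _ i≢j) (updateAt-updates i A)
      M₀ : ∀ u v r → r ≢ i → r ≢ j → M u v r ≡ A r
      M₀ u v r r≢i r≢j = trans (updateAt-minimal r j _ r≢j) (updateAt-minimal r i A r≢i)
      M-diag : ∀ u → F (M u u) ≡ 0ℤ
      M-diag u = alternating i j i≢j λ c → cong-app (trans (Mᵢ u u) (sym (Mⱼ u u))) c
      linear-j : ∀ u → F (M u a+b) ≡ 1ℤ * F (M u a) + F (M u b)
      linear-j u = linear j 1ℤ (λ r r≢j → same r r≢j a) (λ r r≢j → same r r≢j b)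
        λ c → trans (cong-app (Mⱼ u a+b) c)
          (sym (cong₂ (λ f g → 1ℤ * f c + g c) (Mⱼ u a) (Mⱼ u b)))
        where
        same : ∀ r → r ≢ j → ∀ v → M u v r ≗ M u a+b r
        same r r≢j v = cong-app (trans (updateAt-minimal r j _ r≢j)
                                       (sym (updateAt-minimal r j _ r≢j)))
      linear-i : F (M a+b a+b) ≡ 1ℤ * F (M a a+b) + F (M b a+b)
      linear-i = linear i 1ℤ (λ r r≢i → same r r≢i a) (λ r r≢i → same r r≢i b)
        λ c → trans (cong-app (Mᵢ a+b a+b) c)
          (sym (cong₂ (λ f g → 1ℤ * f c + g c) (Mᵢ a a+b) (Mᵢ b a+b)))
        where
        same : ∀ r → r ≢ i → ∀ u → M u a+b r ≗ M a+b a+b r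
        same r r≢i u with r ≟ j
        ... | yes refl = cong-app (trans (Mⱼ u a+b) (sym (Mⱼ a+b a+b)))
        ... | no r≢j   = cong-app (trans (M₀ u a+b r r≢i r≢j) (sym (M₀ a+b a+b r r≢i r≢j)))
      A≈ : A ≈ M a b
      A≈ r c with r ≟ i | r ≟ j
      ... | yes refl | _        = sym (cong-app (Mᵢ a b) c)
      ... | no _     | yes refl = sym (cong-app (Mⱼ a b) c)
      ... | no r≢i   | no r≢j   = sym (cong-app (M₀ a b r r≢i r≢j) c)
      B≈ : B ≈ M b a
      B≈ r c with r ≟ i | r ≟ j
      ... | yes refl | _        = trans (sym (Aⱼ≗Bᵢ c)) (sym (cong-app (Mᵢ b a) c))
      ... | no _     | yes refl = trans (sym (Aᵢ≗Bⱼ c)) (sym (cong-app (Mⱼ b a) c))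
      ... | no r≢i   | no r≢j   =
        trans (sym (A≗B r r≢i r≢j c)) (sym (cong-app (M₀ b a r r≢i r≢j) c))
      pad : ∀ x y → x + y ≡ 1ℤ * (1ℤ * 0ℤ + x) + (1ℤ * y + 0ℤ)
      pad = solve-∀
      negate : ∀ {x y} → x + y ≡ 0ℤ → x ≡ - y
      negate {x} {y} eq = trans (shift x y) (trans (cong (_- y) eq) (ℤP.+-identityˡ (- y)))
        where
        shift : ∀ x y → x ≡ (x + y) - y
        shift = solve-∀

  fix-head : ∀ {n m} {F : Rows (suc n) m → ℤ} → Multilinear F → ∀ v →
             Multilinear (λ R → F (v ∷ R))
  fix-head ml v = record
    { cong-rows = λ A≈B → cong-rows λ { zero _ → refl ; (suc i) → A≈B i }
    ; linear    = λ i x A≗D B≗D eq → linear (suc i) x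
        (λ { zero _ _ → refl ; (suc r) r≢i → A≗D r (r≢i ∘ cong suc) })
        (λ { zero _ _ → refl ; (suc r) r≢i → B≗D r (r≢i ∘ cong suc) })
        eq
    }
    where open Multilinear ml

  expand-head : ∀ {n m} {F : Rows (suc n) m → ℤ} → Multilinear F → ∀ R {k}
                (x : Fin k → ℤ) (u : Rows k m) →
                F ((λ c → ∑ λ i → x i * u i c) ∷ R) ≡ ∑ λ i → x i * F (u i ∷ R)
  expand-head ml R {zero}  x u = Multilinear.zero-row ml _ zero λ _ → refl
  expand-head {F = F} ml R {suc k} x u = trans
    (Multilinear.linear ml zero {A = u zero ∷ R} {B = (λ c → ∑ λ i → x (suc i) * u (suc i) c) ∷ R} (x zero)
      (λ { zero 0≢0 → ⊥-elim (0≢0 refl) ; (suc r) _ _ → refl })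
      (λ { zero 0≢0 → ⊥-elim (0≢0 refl) ; (suc r) _ _ → refl })
      λ _ → refl)
    (cong (λ z → x zero * F (u zero ∷ R) + z) (expand-head ml R (x ∘ suc) (u ∘ suc)))

  -- Rows are cleared one at a time from the top, and the finished ones are frozen by `fix-head`.
  -- Alternation supplies `vanish` when `v` already stands in a further, fixed row.
  add-multiples : ∀ {n m} {F : Rows n m → ℤ} → Multilinear F → ∀ v →
                  (∀ A i → A i ≗ v → F A ≡ 0ℤ) → ∀ {A B} (x : Fin n → ℤ) →
                  (∀ i c → A i c ≡ x i * v c + B i c) → F A ≡ F B
  add-multiples {zero}  ml v vanish x eq = Multilinear.cong-rows ml λ ()
  add-multiples {suc n} {F = F} ml v vanish {A} {B} x eq = begin
    F A
      ≡⟨ linear zero {A = v ∷ tail A} {B = B zero ∷ tail A} (x zero) same same (eq zero) ⟩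
    x zero * F (v ∷ tail A) + F (B zero ∷ tail A)
      ≡⟨ cong (λ z → x zero * z + F (B zero ∷ tail A)) (vanish (v ∷ tail A) zero λ _ → refl) ⟩
    x zero * 0ℤ + F (B zero ∷ tail A)
      ≡⟨ drop (x zero) (F (B zero ∷ tail A)) ⟩
    F (B zero ∷ tail A)
      ≡⟨ add-multiples (fix-head ml (B zero)) v (λ R i → vanish (B zero ∷ R) (suc i))
           {tail A} {tail B} (λ i → x (suc i)) (λ i → eq (suc i)) ⟩
    F (B zero ∷ tail B)
      ≡⟨ cong-rows (λ { zero _ → refl ; (suc _) _ → refl }) ⟩
    F B ∎
    where
    open Multilinear ml
    same : ∀ {u : _ → ℤ} r → r ≢ zero → (u ∷ tail A) r ≗ A r
    same zero 0≢0    = ⊥-elim (0≢0 refl)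
    same (suc r) _ _ = refl
    drop : ∀ x y → x * 0ℤ + y ≡ y
    drop = solve-∀

  -- The identity matrix, and the determinant as an alternating form

  𝟙 : ∀ {n m} → Rows n m
  𝟙 zero    zero    = 1ℤ
  𝟙 zero    (suc _) = 0ℤ
  𝟙 (suc _) zero    = 0ℤ
  𝟙 (suc i) (suc j) = 𝟙 i j

  ∑-𝟙 : ∀ {n} (i : Fin n) (f : Fin n → ℤ) → ∑ (λ j → 𝟙 i j * f j) ≡ f i
  ∑-𝟙 {suc n} zero    f = trans
    (cong (λ z → 1ℤ * f zero + z) (∑-zero {n} λ j → ℤP.*-zeroˡ (f (suc j))))
    (simp (f zero))
    where
    simp : ∀ x → 1ℤ * x + 0ℤ ≡ x
    simp = solve-∀
  ∑-𝟙 {suc n} (suc i) f = trans (cong₂ _+_ (ℤP.*-zeroˡ (f zero)) (∑-𝟙 i (f ∘ suc)))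
    (ℤP.+-identityˡ _)

  𝟙-sym : ∀ {n m} (i : Fin n) (j : Fin m) → 𝟙 i j ≡ 𝟙 j i
  𝟙-sym zero    zero    = refl
  𝟙-sym zero    (suc _) = refl
  𝟙-sym (suc _) zero    = refl
  𝟙-sym (suc i) (suc j) = 𝟙-sym i j

  det-multilinear : ∀ n → Multilinear (det {n})
  det-multilinear zero = record { cong-rows = λ _ → refl ; linear = λ () }
  det-multilinear (suc n) = record { cong-rows = cong-rows′ ; linear = linear′ }
    where
    open Multilinear (det-multilinear n)
    cong-rows′ : ∀ {A B : Matrix (suc n)} → A ≈ B → det A ≡ det B
    cong-rows′ A≈B = ∑-cong λ j → cong₂ (λ a d → -1ℤ ^ toℕ j * a * d) (A≈B zero j)
      (cong-rows λ r c → A≈B (suc r) (punchIn j c))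
    minor : Matrix (suc n) → Fin (suc n) → ℤ
    minor A j = det λ r c → A (suc r) (punchIn j c)
    term : Matrix (suc n) → Fin (suc n) → ℤ
    term A j = -1ℤ ^ toℕ j * A zero j * minor A j
    distribute₁ : ∀ x s a b d → s * (x * a + b) * d ≡ x * (s * a * d) + s * b * d
    distribute₁ = solve-∀
    distribute₂ : ∀ x s d e → s * (x * d + e) ≡ x * (s * d) + s * e
    distribute₂ = solve-∀
    linear′ : ∀ i {A B D : Matrix (suc n)} x → (∀ r → r ≢ i → A r ≗ D r) →
              (∀ r → r ≢ i → B r ≗ D r) →
              (∀ c → D i c ≡ x * A i c + B i c) → det D ≡ x * det A + det B
    linear′ zero {A} {B} {D} x A≗D B≗D eq = ∑-linear x (term A) (term B) λ j → begin
      -1ℤ ^ toℕ j * D zero j * minor D j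
        ≡⟨ cong (λ z → -1ℤ ^ toℕ j * z * minor D j) (eq j) ⟩
      -1ℤ ^ toℕ j * (x * A zero j + B zero j) * minor D j
        ≡⟨ distribute₁ x (-1ℤ ^ toℕ j) (A zero j) (B zero j) (minor D j) ⟩
      x * (-1ℤ ^ toℕ j * A zero j * minor D j) + -1ℤ ^ toℕ j * B zero j * minor D j
        ≡⟨ cong₂ (λ d e → x * (-1ℤ ^ toℕ j * A zero j * d) + -1ℤ ^ toℕ j * B zero j * e)
             (cong-rows λ r c → A≗D (suc r) (λ ()) (punchIn j c))
             (cong-rows λ r c → B≗D (suc r) (λ ()) (punchIn j c)) ⟨
      x * term A j + term B j ∎
    linear′ (suc i) {A} {B} {D} x A≗D B≗D eq = ∑-linear x (term A) (term B) λ j → begin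
      -1ℤ ^ toℕ j * D zero j * minor D j
        ≡⟨ cong (-1ℤ ^ toℕ j * D zero j *_) (linear i x
             (λ r r≢i c → A≗D (suc r) (r≢i ∘ suc-injective) (punchIn j c))
             (λ r r≢i c → B≗D (suc r) (r≢i ∘ suc-injective) (punchIn j c))
             (λ c → eq (punchIn j c))) ⟩
      -1ℤ ^ toℕ j * D zero j * (x * minor A j + minor B j)
        ≡⟨ distribute₂ x (-1ℤ ^ toℕ j * D zero j) (minor A j) (minor B j) ⟩
      x * (-1ℤ ^ toℕ j * D zero j * minor A j) + -1ℤ ^ toℕ j * D zero j * minor B j
        ≡⟨ cong₂ (λ a b → x * (-1ℤ ^ toℕ j * a * minor A j) + -1ℤ ^ toℕ j * b * minor B j)
             (A≗D zero (λ ()) j) (B≗D zero (λ ()) j) ⟨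
      x * term A j + term B j ∎

  det-cong : ∀ {n} {A B : Matrix n} → A ≈ B → det A ≡ det B
  det-cong {n} = Multilinear.cong-rows (det-multilinear n)

  -- Passes from the row `a` to `a ∘ suc` in the double expansion: `Φ ∘ lift` keeps column 0 in the
  -- minor throughout.
  lift : ∀ {n m} → (Fin n → Fin m) → Fin (suc n) → Fin (suc m)
  lift e zero    = zero
  lift e (suc c) = suc (e c)

  -- The double expansion along two equal rows a. The summands (0, k) and (k + 1, 0) cancel,
  -- and the remaining ones form a sum of the same shape; Φ stands for the minor of the
  -- remaining rows on the columns given by an injection.
  double-expansion-vanishes : ∀ n (a : Fin (2 ℕ.+ n) → ℤ) (Φ : (Fin n → Fin (2 ℕ.+ n)) → ℤ) →
    (∀ {e f} → e ≗ f → Φ e ≡ Φ f) →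
    ∑ (λ j → -1ℤ ^ toℕ j * a j * ∑ λ k → -1ℤ ^ toℕ k * a (punchIn j k) *
         Φ (λ c → punchIn j (punchIn k c))) ≡ 0ℤ
  double-expansion-vanishes n a Φ Φ-cong = begin
    1ℤ * a zero * ∑ first + ∑ later
      ≡⟨ cong (_+ ∑ later) (begin
           1ℤ * a zero * ∑ first           ≡⟨ ΣP.*-distribˡ-sum (1ℤ * a zero) first ⟩
           ∑ (λ k → 1ℤ * a zero * first k) ≡⟨ regroup (∑ λ k → 1ℤ * a zero * first k) ⟩
           -1ℤ * (-1ℤ * ∑ (λ k → 1ℤ * a zero * first k) + 0ℤ) ∎) ⟩
    -1ℤ * (-1ℤ * ∑ (λ k → 1ℤ * a zero * first k) + 0ℤ) + ∑ later
      -- The padding zero is replaced by `∑ rest`, which is itself zero by `remaining`. The first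
      -- summand thereby becomes -1 times the second.
      ≡⟨ cong₂ (λ z w → -1ℤ * (-1ℤ * ∑ (λ k → 1ℤ * a zero * first k) + z) + w)
           (sym (remaining n a Φ Φ-cong)) (∑-linear -1ℤ (λ k → 1ℤ * a zero * first k) rest split) ⟩
    -1ℤ * (-1ℤ * ∑ (λ k → 1ℤ * a zero * first k) + ∑ rest)
      + (-1ℤ * ∑ (λ k → 1ℤ * a zero * first k) + ∑ rest)
      ≡⟨ cancel (-1ℤ * ∑ (λ k → 1ℤ * a zero * first k) + ∑ rest) ⟩
    0ℤ ∎
    where
    first : Fin (suc n) → ℤ
    first k = -1ℤ ^ toℕ k * a (suc k) * Φ (λ c → suc (punchIn k c))
    later rest : Fin (suc n) → ℤ
    later j = -1ℤ ^ suc (toℕ j) * a (suc j) * ∑ λ k → -1ℤ ^ toℕ k * a (punchIn (suc j) k) *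
         Φ (λ c → punchIn (suc j) (punchIn k c))
    rest j = -1ℤ ^ suc (toℕ j) * a (suc j) * ∑ λ k → -1ℤ ^ suc (toℕ k) * a (suc (punchIn j k)) *
         Φ (λ c → punchIn (suc j) (punchIn (suc k) c))
    regroup : ∀ x → x ≡ -1ℤ * (-1ℤ * x + 0ℤ)
    regroup = solve-∀
    cancel : ∀ x → -1ℤ * x + x ≡ 0ℤ
    cancel = solve-∀
    expand : ∀ s a₀ a₁ φ r →
      (-1ℤ * s) * a₁ * (1ℤ * a₀ * φ + r) ≡ -1ℤ * (1ℤ * a₀ * (s * a₁ * φ)) + (-1ℤ * s) * a₁ * r
    expand = solve-∀
    split : ∀ j → later j ≡ -1ℤ * (1ℤ * a zero * first j) + rest j
    split j = expand (-1ℤ ^ toℕ j) (a zero) (a (suc j)) (Φ (λ c → suc (punchIn j c)))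
      (∑ λ k → -1ℤ ^ suc (toℕ k) * a (suc (punchIn j k)) * Φ (λ c → punchIn (suc j) (punchIn (suc k) c)))
    remaining : ∀ n (a : Fin (2 ℕ.+ n) → ℤ) (Φ : (Fin n → Fin (2 ℕ.+ n)) → ℤ) →
      (∀ {e f} → e ≗ f → Φ e ≡ Φ f) →
      ∑ (λ j → -1ℤ ^ suc (toℕ j) * a (suc j) * ∑ λ k → -1ℤ ^ suc (toℕ k) * a (suc (punchIn j k)) *
         Φ (λ c → punchIn (suc j) (punchIn (suc k) c))) ≡ 0ℤ
    remaining zero a Φ Φ-cong = zero-term (a (suc zero))
      where
      zero-term : ∀ x → -1ℤ * 1ℤ * x * 0ℤ + 0ℤ ≡ 0ℤ
      zero-term = solve-∀
    remaining (suc n) a Φ Φ-cong = trans (∑-cong λ j → begin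
        -1ℤ ^ suc (toℕ j) * a (suc j) * ∑ (λ k → -1ℤ ^ suc (toℕ k) * a (suc (punchIn j k)) *
          Φ (λ c → punchIn (suc j) (punchIn (suc k) c)))
          ≡⟨ cong (-1ℤ ^ suc (toℕ j) * a (suc j) *_) (trans (∑-linear -1ℤ (inner j) (λ _ → 0ℤ) λ k → begin
               -1ℤ ^ suc (toℕ k) * a (suc (punchIn j k)) *
                 Φ (λ c → punchIn (suc j) (punchIn (suc k) c))
                 ≡⟨ cong (-1ℤ ^ suc (toℕ k) * a (suc (punchIn j k)) *_)
                      (Φ-cong λ { zero → refl ; (suc c) → refl }) ⟩
               -1ℤ ^ suc (toℕ k) * a (suc (punchIn j k)) * Φ (lift λ c → punchIn j (punchIn k c))
                 ≡⟨ sign₁ (-1ℤ ^ toℕ k) (a (suc (punchIn j k))) (Φ (lift λ c → punchIn j (punchIn k c))) ⟩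
               -1ℤ * inner j k + 0ℤ ∎)
               (cong (λ z → -1ℤ * ∑ (inner j) + z) (∑-zero {suc n} λ _ → refl))) ⟩
        -1ℤ ^ suc (toℕ j) * a (suc j) * (-1ℤ * ∑ (inner j) + 0ℤ)
          ≡⟨ sign₂ (-1ℤ ^ toℕ j) (a (suc j)) (∑ (inner j)) ⟩
        -1ℤ ^ toℕ j * a (suc j) * ∑ (inner j) ∎)
      (double-expansion-vanishes n (a ∘ suc) (Φ ∘ lift)
        λ e≗f → Φ-cong λ { zero → refl ; (suc c) → cong suc (e≗f c) })
      where
      inner : Fin (2 ℕ.+ n) → Fin (suc n) → ℤ
      inner j k = -1ℤ ^ toℕ k * a (suc (punchIn j k)) * Φ (lift λ c → punchIn j (punchIn k c))
      sign₁ : ∀ s a φ → (-1ℤ * s) * a * φ ≡ -1ℤ * (s * a * φ) + 0ℤ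
      sign₁ = solve-∀
      sign₂ : ∀ s a x → (-1ℤ * s) * a * (-1ℤ * x + 0ℤ) ≡ s * a * x
      sign₂ = solve-∀

  private
    -- If the rows are adjacent, this is the double expansion. Otherwise the lower one is exchanged
    -- with row 1 inside every minor, which costs only a sign because the minors are alternating by
    -- hypothesis.
    det-first-row : ∀ n → Alternating (det {n}) → ∀ {A : Matrix (suc n)} j →
                    A zero ≗ A (suc j) → det A ≡ 0ℤ
    det-first-row (suc n) alt {A} zero eq = trans
      (∑-cong λ j → cong (-1ℤ ^ toℕ j * A zero j *_) (∑-cong λ k →
        cong (λ z → -1ℤ ^ toℕ k * z * det λ r c → A (suc (suc r)) (punchIn j (punchIn k c)))
             (sym (eq (punchIn j k)))))
      (double-expansion-vanishes n (A zero) (λ e → det λ r c → A (suc (suc r)) (e c))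
        λ e≗f → det-cong λ r c → cong (A (suc (suc r))) (e≗f c))
    det-first-row (suc n) alt {A} (suc j) eq = begin
      det A            ≡⟨ ∑-linear -1ℤ (λ c → -1ℤ ^ toℕ c * A zero c * minor c) (λ _ → 0ℤ)
                            (λ c → trans (cong (-1ℤ ^ toℕ c * A zero c *_) (swapped c))
                            (sign (-1ℤ ^ toℕ c) (A zero c) (minor c))) ⟩
      -1ℤ * det B + ∑ {suc (suc n)} (λ _ → 0ℤ) ≡⟨ cong₂ (λ x y → -1ℤ * x + y)
                            (det-first-row (suc n) alt {B} zero eq) (∑-zero {suc (suc n)} λ _ → refl) ⟩
      0ℤ               ∎
      where
      A″ = λ r → A (suc (suc r))
      B : Matrix (suc (suc n))
      B zero          = A zero
      B (suc zero)    = A (suc (suc j))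
      B (suc (suc r)) = updateAt A″ j (λ _ → A (suc zero)) r
      minor : Fin (suc (suc n)) → ℤ
      minor c = det λ r d → B (suc r) (punchIn c d)
      swapped : ∀ c → det (λ r d → A (suc r) (punchIn c d)) ≡ - minor c
      swapped c = Alternating.swap-rows alt
        {λ r d → A (suc r) (punchIn c d)} {λ r d → B (suc r) (punchIn c d)} zero (suc j) (λ ())
        (λ { zero 0≢0 _ → ⊥-elim (0≢0 refl)
           ; (suc r) _ r≢j d → sym (cong-app (updateAt-minimal r j A″ (r≢j ∘ cong suc)) (punchIn c d)) })
        (λ d → sym (cong-app (updateAt-updates j A″) (punchIn c d)))
        (λ _ → refl)
      sign : ∀ s a x → s * a * - x ≡ -1ℤ * (s * a * x) + 0ℤ
      sign = solve-∀

  det-alternating : ∀ n → Alternating (det {n})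
  det-alternating n = record { multilinear = det-multilinear n ; alternating = alternating n }
    where
    alternating : ∀ n {A : Matrix n} i j → i ≢ j → A i ≗ A j → det A ≡ 0ℤ
    alternating (suc n) zero zero 0≢0 eq = ⊥-elim (0≢0 refl)
    alternating (suc n) {A} zero (suc j) _ eq = det-first-row n
      (record { multilinear = det-multilinear n ; alternating = alternating n }) {A} j eq
    alternating (suc n) {A} (suc i) zero _ eq = det-first-row n
      (record { multilinear = det-multilinear n ; alternating = alternating n }) {A} i (sym ∘ eq)
    alternating (suc n) {A} (suc i) (suc j) i≢j eq = ∑-zero λ c → trans
      (cong (-1ℤ ^ toℕ c * A zero c *_) (alternating n i j (i≢j ∘ cong suc) λ d → eq (punchIn c d)))
      (ℤP.*-zeroʳ (-1ℤ ^ toℕ c * A zero c))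

  -- Uniqueness of alternating forms and the product rule

  private
    insertAt-𝟙 : ∀ {n} (j : Fin (suc n)) (i : Fin n) →
                 insertAt (𝟙 i) j 0ℤ ≗ 𝟙 (punchIn j i)
    insertAt-𝟙 zero    i       zero    = refl
    insertAt-𝟙 zero    i       (suc c) = refl
    insertAt-𝟙 (suc j) zero    zero    = refl
    insertAt-𝟙 (suc j) zero    (suc c) = zeros j c
      where
      zeros : ∀ {n} (j : Fin (suc n)) → insertAt (λ _ → 0ℤ) j 0ℤ ≗ λ _ → 0ℤ
      zeros zero zero = refl
      zeros zero (suc c) = refl
      zeros {suc n} (suc j) zero = refl
      zeros {suc n} (suc j) (suc c) = zeros j c
    insertAt-𝟙 (suc j) (suc i) zero    = refl
    insertAt-𝟙 (suc j) (suc i) (suc c) = insertAt-𝟙 j i c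

    clear-entry : ∀ {n} (u : Fin (suc n) → ℤ) j c →
                  u c ≡ u j * 𝟙 j c + insertAt (removeAt u j) j 0ℤ c
    clear-entry u zero zero = simp (u zero)
      where
      simp : ∀ x → x ≡ x * 1ℤ + 0ℤ
      simp = solve-∀
    clear-entry u zero (suc c) = simp (u zero) (u (suc c))
      where
      simp : ∀ x y → y ≡ x * 0ℤ + y
      simp = solve-∀
    clear-entry {suc n} u (suc j) zero = simp (u (suc j)) (u zero)
      where
      simp : ∀ x y → y ≡ x * 0ℤ + y
      simp = solve-∀
    clear-entry {suc n} u (suc j) (suc c) = clear-entry (u ∘ suc) j c

    insertAt-linear : ∀ {n} (j : Fin (suc n)) x {u v w : Fin n → ℤ} →
      (∀ c → w c ≡ x * u c + v c) → ∀ c →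
      insertAt w j 0ℤ c ≡ x * insertAt u j 0ℤ c + insertAt v j 0ℤ c
    insertAt-linear zero x eq zero = simp x
      where
      simp : ∀ x → 0ℤ ≡ x * 0ℤ + 0ℤ
      simp = solve-∀
    insertAt-linear zero x eq (suc c) = eq c
    insertAt-linear {suc n} (suc j) x eq zero = eq zero
    insertAt-linear {suc n} (suc j) x eq (suc c) = insertAt-linear j x (eq ∘ suc) c

    insertAt-cong : ∀ {n} (j : Fin (suc n)) {u v : Fin n → ℤ} → u ≗ v →
                    insertAt u j 0ℤ ≗ insertAt v j 0ℤ
    insertAt-cong zero eq zero = refl
    insertAt-cong zero eq (suc c) = eq c
    insertAt-cong {suc n} (suc j) eq zero = eq zero
    insertAt-cong {suc n} (suc j) eq (suc c) = insertAt-cong j (eq ∘ suc) c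

    punchIn-suc-self : ∀ {n} (j : Fin n) → punchIn (suc j) j ≡ inject₁ j
    punchIn-suc-self zero = refl
    punchIn-suc-self (suc j) = cong suc (punchIn-suc-self j)

    punchIn-inject₁-self : ∀ {n} (j : Fin n) → punchIn (inject₁ j) j ≡ suc j
    punchIn-inject₁-self zero = refl
    punchIn-inject₁-self (suc j) = cong suc (punchIn-inject₁-self j)

    punchIn-suc-other : ∀ {n} (j r : Fin n) → r ≢ j → punchIn (suc j) r ≡ punchIn (inject₁ j) r
    punchIn-suc-other zero zero r≢j = ⊥-elim (r≢j refl)
    punchIn-suc-other zero (suc r) r≢j = refl
    punchIn-suc-other (suc j) zero r≢j = refl
    punchIn-suc-other (suc j) (suc r) r≢j = cong suc (punchIn-suc-other j r (r≢j ∘ cong suc))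

  -- Exchanging the head with the row in position `suc j` turns the arrangement for `suc j` into the
  -- one for `inject₁ j`, so each step up costs one sign.
  cycle-rows : ∀ {n m} {F : Rows (suc n) m → ℤ} → Alternating F → ∀ (A : Rows (suc n) m) j →
               F (A j ∷ λ i → A (punchIn j i)) ≡ -1ℤ ^ toℕ j * F A
  cycle-rows {n} {m} {F} alt A j = go (toℕ j) j refl
    where
    open Alternating alt
    sign : ∀ s x → - (s * x) ≡ -1ℤ * s * x
    sign = solve-∀
    -- `inject₁ j` is not structurally smaller than `suc j`, so the recursion is on the numerical
    -- value.
    go : ∀ k j → toℕ j ≡ k → F (A j ∷ λ i → A (punchIn j i)) ≡ -1ℤ ^ k * F A
    go zero zero refl = trans (cong-rows λ { zero _ → refl ; (suc _) _ → refl })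
      (sym (ℤP.*-identityˡ (F A)))
    go (suc k) (suc j) eq = begin
      F (A (suc j) ∷ λ i → A (punchIn (suc j) i))
        ≡⟨ swap-rows zero (suc j) (λ ())
             (λ { zero 0≢0 _ → ⊥-elim (0≢0 refl)
                ; (suc r) _ r≢j → cong-app (cong A (punchIn-suc-other j r (r≢j ∘ cong suc))) })
             (cong-app (cong A (sym (punchIn-inject₁-self j))))
             (cong-app (cong A (punchIn-suc-self j))) ⟩
      - F (A (inject₁ j) ∷ λ i → A (punchIn (inject₁ j) i))
        ≡⟨ cong -_ (go k (inject₁ j) (trans (toℕ-inject₁ j) (cong ℕ.pred eq))) ⟩
      - (-1ℤ ^ k * F A)
        ≡⟨ sign (-1ℤ ^ k) (F A) ⟩
      -1ℤ ^ suc k * F A ∎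

  -- By linearity the first row may be taken to be `𝟙 j`. Its multiples clear column `j` from the
  -- other rows, and what is left is an alternating form `G j` in the minor, to which induction
  -- applies. The cofactor sign is the cost of cycling the rows of the identity.
  alternating-unique : ∀ {n} {F : Matrix n → ℤ} → Alternating F → ∀ A → F A ≡ det A * F 𝟙
  alternating-unique {zero} {F} alt A = trans (Alternating.cong-rows alt λ ()) (sym (ℤP.*-identityˡ (F 𝟙)))
  alternating-unique {suc n} {F} alt A = begin
    F A
      ≡⟨ cong-rows (λ { zero c → head-eq c ; (suc _) _ → refl }) ⟩
    F ((λ c → ∑ λ j → A zero j * 𝟙 j c) ∷ tail A)
      ≡⟨ expand-head multilinear (tail A) (A zero) 𝟙 ⟩
    ∑ (λ j → A zero j * F (𝟙 j ∷ tail A))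
      ≡⟨ ∑-cong (λ j → trans (cong (A zero j *_) (term j)) (shuffle (A zero j) (minor j) (-1ℤ ^ toℕ j) (F 𝟙))) ⟩
    ∑ (λ j → -1ℤ ^ toℕ j * A zero j * minor j * F 𝟙)
      ≡⟨ ΣP.*-distribʳ-sum (F 𝟙) (λ j → -1ℤ ^ toℕ j * A zero j * minor j) ⟨
    det A * F 𝟙 ∎
    where
    open Alternating alt
    minor : Fin (suc n) → ℤ
    minor j = det λ r c → A (suc r) (punchIn j c)
    head-eq : ∀ c → A zero c ≡ ∑ λ j → A zero j * 𝟙 j c
    head-eq c = sym (trans
      (∑-cong λ j → trans (ℤP.*-comm (A zero j) (𝟙 j c)) (cong (_* A zero j) (𝟙-sym j c)))
      (∑-𝟙 c (A zero)))
    shuffle : ∀ a m s f → a * (m * (s * f)) ≡ s * a * m * f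
    shuffle = solve-∀
    G : Fin (suc n) → Matrix n → ℤ
    G j B = F (𝟙 j ∷ λ r → insertAt (B r) j 0ℤ)
    G-alternating : ∀ j → Alternating (G j)
    G-alternating j = record
      { multilinear = record
        { cong-rows = λ A≈B → cong-rows λ { zero _ → refl ; (suc i) → insertAt-cong j (A≈B i) }
        ; linear    = λ i x A≗D B≗D eq → linear (suc i) x
            (λ { zero _ _ → refl ; (suc r) r≢i → insertAt-cong j (A≗D r (r≢i ∘ cong suc)) })
            (λ { zero _ _ → refl ; (suc r) r≢i → insertAt-cong j (B≗D r (r≢i ∘ cong suc)) })
            (insertAt-linear j x eq)
        }
      ; alternating = λ i i′ i≢i′ eq → alternating (suc i) (suc i′) (i≢i′ ∘ suc-injective)
          (insertAt-cong j eq)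
      }
    term : ∀ j → F (𝟙 j ∷ tail A) ≡ minor j * (-1ℤ ^ toℕ j * F 𝟙)
    term j = begin
      F (𝟙 j ∷ tail A)
        ≡⟨ add-multiples (fix-head multilinear (𝟙 j)) (𝟙 j)
             (λ R i eq → alternating zero (suc i) (λ ()) (sym ∘ eq))
             {tail A} {λ r → insertAt (λ c → A (suc r) (punchIn j c)) j 0ℤ}
             (λ r → A (suc r) j) (λ r → clear-entry (A (suc r)) j) ⟩
      G j (λ r c → A (suc r) (punchIn j c))
        ≡⟨ alternating-unique (G-alternating j) _ ⟩
      minor j * G j 𝟙
        ≡⟨ cong (minor j *_) (trans
             (cong-rows λ { zero _ → refl ; (suc i) → insertAt-𝟙 j i })
             (cycle-rows alt 𝟙 j)) ⟩
      minor j * (-1ℤ ^ toℕ j * F 𝟙) ∎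

  infixl 7 _·_
  _·_ : ∀ {n m l} → Rows n m → Rows m l → Rows n l
  (A · B) i j = ∑ λ k → A i k * B k j

  -- For fixed `B`, `det (A · B)` is alternating in `A` and has the value `det B` at the identity,
  -- which determines it.
  det-· : ∀ {n} (A B : Matrix n) → det (A · B) ≡ det A * det B
  det-· {n} A B = trans (alternating-unique ·B-alternating A)
    (cong (det A *_) (det-cong λ i j → ∑-𝟙 i (λ k → B k j)))
    where
    open Alternating (det-alternating n)
    distribute : ∀ x a a′ b → (x * a + a′) * b ≡ x * (a * b) + a′ * b
    distribute = solve-∀
    ·-cong : ∀ {u v : Fin n → ℤ} → u ≗ v → ∀ j → ∑ (λ k → u k * B k j) ≡ ∑ (λ k → v k * B k j)
    ·-cong u≗v j = ∑-cong λ k → cong (_* B k j) (u≗v k)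
    ·B-alternating : Alternating (λ A → det (A · B))
    ·B-alternating = record
      { multilinear = record
        { cong-rows = λ A≈A′ → cong-rows λ i → ·-cong (A≈A′ i)
        ; linear    = λ i {A} {A′} {D} x A≗D A′≗D eq → linear i {A · B} {A′ · B} {D · B} x
            (λ r r≢i → ·-cong (A≗D r r≢i)) (λ r r≢i → ·-cong (A′≗D r r≢i))
            λ c → ∑-linear x (λ k → A i k * B k c) (λ k → A′ i k * B k c) λ k →
              trans (cong (_* B k c) (eq k)) (distribute x (A i k) (A′ i k) (B k c))
        }
      ; alternating = λ i j i≢j eq → alternating i j i≢j (·-cong eq)
      }

  -- Determinants of block matrices and of scaled matrices

  ∑-scale : ∀ {n} x (f : Fin n → ℤ) {h : Fin n → ℤ} → (∀ i → h i ≡ x * f i) → ∑ h ≡ x * ∑ f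
  ∑-scale x f eq = trans (∑-cong eq) (sym (ΣP.*-distribˡ-sum x f))

  det-first-column-zero : ∀ {n} (A : Matrix (suc n)) → (∀ r → A r zero ≡ 0ℤ) → det A ≡ 0ℤ
  det-first-column-zero {zero} A A₀≡0 = trans
    (cong (λ z → 1ℤ * z * 1ℤ + 0ℤ) (A₀≡0 zero)) refl
  det-first-column-zero {suc n} A A₀≡0 = ∑-zero {f = λ j → -1ℤ ^ toℕ j * A zero j * minor j} λ
    { zero    → trans (cong (λ z → 1ℤ * z * minor zero) (A₀≡0 zero)) (ℤP.*-zeroˡ (minor zero))
    ; (suc j) → trans
        (cong (-1ℤ ^ suc (toℕ j) * A zero (suc j) *_)
          (det-first-column-zero (λ r c → A (suc r) (punchIn (suc j) c)) (A₀≡0 ∘ suc)))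
        (ℤP.*-zeroʳ (-1ℤ ^ suc (toℕ j) * A zero (suc j)))
    }
    where
    minor : Fin (suc (suc n)) → ℤ
    minor j = det λ r c → A (suc r) (punchIn j c)

  private
    1*a*m+0 : ∀ a m → 1ℤ * a * m + 0ℤ ≡ a * m
    1*a*m+0 = solve-∀

  det-block-lower : ∀ {n} (A : Matrix (suc n)) → (∀ c → A zero (suc c) ≡ 0ℤ) →
                    det A ≡ A zero zero * det (λ r c → A (suc r) (suc c))
  det-block-lower {n} A A₀≡0 = trans
    (cong (λ z → 1ℤ * A zero zero * det (λ r c → A (suc r) (suc c)) + z) (∑-zero {n} λ j →
      trans (cong (λ z → -1ℤ ^ suc (toℕ j) * z * minor j) (A₀≡0 j)) (zero-factor (-1ℤ ^ suc (toℕ j)) (minor j))))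
    (1*a*m+0 (A zero zero) (det λ r c → A (suc r) (suc c)))
    where
    minor : Fin n → ℤ
    minor j = det λ r c → A (suc r) (punchIn (suc j) c)
    zero-factor : ∀ s m → s * 0ℤ * m ≡ 0ℤ
    zero-factor = solve-∀

  -- In the expansion every minor but the first retains the zero column.
  det-block-upper : ∀ {n} (A : Matrix (suc n)) → (∀ r → A (suc r) zero ≡ 0ℤ) →
                    det A ≡ A zero zero * det (λ r c → A (suc r) (suc c))
  det-block-upper {zero}  A A₀≡0 = 1*a*m+0 (A zero zero) 1ℤ
  det-block-upper {suc n} A A₀≡0 = trans
    (cong (λ z → 1ℤ * A zero zero * det (λ r c → A (suc r) (suc c)) + z) (∑-zero λ j →
      trans (cong (-1ℤ ^ suc (toℕ j) * A zero (suc j) *_)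
              (det-first-column-zero (λ r c → A (suc r) (punchIn (suc j) c)) A₀≡0))
            (ℤP.*-zeroʳ (-1ℤ ^ suc (toℕ j) * A zero (suc j)))))
    (1*a*m+0 (A zero zero) (det λ r c → A (suc r) (suc c)))

  det-scale-rows : ∀ {n} (d : Fin n → ℤ) (A : Matrix n) →
                   det (λ i j → d i * A i j) ≡ ∏ d * det A
  det-scale-rows {zero}  d A = refl
  det-scale-rows {suc n} d A = ∑-scale (∏ d) (λ j → -1ℤ ^ toℕ j * A zero j * minor j) λ j → trans
    (cong (-1ℤ ^ toℕ j * (d zero * A zero j) *_)
      (det-scale-rows (d ∘ suc) (λ r c → A (suc r) (punchIn j c))))
    (regroup (-1ℤ ^ toℕ j) (d zero) (A zero j) (∏ (d ∘ suc)) (minor j))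
    where
    minor : Fin (suc n) → ℤ
    minor j = det λ r c → A (suc r) (punchIn j c)
    regroup : ∀ s d a e m → s * (d * a) * (e * m) ≡ d * e * (s * a * m)
    regroup = solve-∀

  det-scale-columns : ∀ {n} (d : Fin n → ℤ) (A : Matrix n) →
                      det (λ i j → d j * A i j) ≡ ∏ d * det A
  det-scale-columns {zero}  d A = refl
  det-scale-columns {suc n} d A = ∑-scale (∏ d) (λ j → -1ℤ ^ toℕ j * A zero j * minor j) λ j → begin
    -1ℤ ^ toℕ j * (d j * A zero j) * det (λ r c → d (punchIn j c) * A (suc r) (punchIn j c))
      ≡⟨ cong (-1ℤ ^ toℕ j * (d j * A zero j) *_)
           (det-scale-columns (λ c → d (punchIn j c)) (λ r c → A (suc r) (punchIn j c))) ⟩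
    -1ℤ ^ toℕ j * (d j * A zero j) * (∏ (λ c → d (punchIn j c)) * minor j)
      ≡⟨ regroup (-1ℤ ^ toℕ j) (d j) (A zero j) (∏ λ c → d (punchIn j c)) (minor j) ⟩
    d j * ∏ (λ c → d (punchIn j c)) * (-1ℤ ^ toℕ j * A zero j * minor j)
      -- The minor omits column `j`, and the missing factor `d j` comes from the entry in the first
      -- row.
      ≡⟨ cong (_* (-1ℤ ^ toℕ j * A zero j * minor j)) (ΠP.sum-remove {i = j} d) ⟨
    ∏ d * (-1ℤ ^ toℕ j * A zero j * minor j) ∎
    where
    minor : Fin (suc n) → ℤ
    minor j = det λ r c → A (suc r) (punchIn j c)
    regroup : ∀ s d a e m → s * (d * a) * (e * m) ≡ d * e * (s * a * m)
    regroup = solve-∀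

  -- The Vandermonde determinant

  -- Right multiplication by shear t subtracts t times column c from column c + 1.
  shear : ∀ {n} → ℤ → Matrix n
  shear t zero    zero          = 1ℤ
  shear t zero    (suc zero)    = - t
  shear t zero    (suc (suc _)) = 0ℤ
  shear t (suc _) zero          = 0ℤ
  shear t (suc r) (suc c)       = shear t r c

  det-shear : ∀ {n} t → det (shear {n} t) ≡ 1ℤ
  det-shear {zero}  t = refl
  det-shear {suc n} t = trans (det-block-upper (shear {suc n} t) λ _ → refl)
    (trans (ℤP.*-identityˡ (det (shear {n} t))) (det-shear {n} t))

  det-shearᵀ : ∀ {n} t → det (flip (shear {n} t)) ≡ 1ℤ
  det-shearᵀ {zero}  t = refl
  det-shearᵀ {suc n} t = trans (det-block-lower (flip (shear {suc n} t)) λ _ → refl)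
    (trans (ℤP.*-identityˡ (det (flip (shear {n} t)))) (det-shearᵀ {n} t))

  ∑-shear-zero : ∀ {n} t (f : Fin (suc n) → ℤ) → ∑ (λ k → f k * shear t k zero) ≡ f zero
  ∑-shear-zero {n} t f = trans
    (cong (λ z → f zero * 1ℤ + z) (∑-zero {n} λ k → ℤP.*-zeroʳ (f (suc k))))
    (simp (f zero))
    where
    simp : ∀ x → x * 1ℤ + 0ℤ ≡ x
    simp = solve-∀

  ∑-shear-suc : ∀ {n} t (f : Fin (suc n) → ℤ) c →
                ∑ (λ k → f k * shear t k (suc c)) ≡ f (suc c) - t * f (inject₁ c)
  ∑-shear-suc {suc n} t f zero = trans
    (cong (λ z → f zero * - t + z) (∑-shear-zero {n} t (f ∘ suc)))
    (simp t (f zero) (f (suc zero)))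
    where
    simp : ∀ t x y → x * - t + y ≡ y - t * x
    simp = solve-∀
  ∑-shear-suc {suc n} t f (suc c) = trans
    (cong (λ z → f zero * 0ℤ + z) (∑-shear-suc t (f ∘ suc) c))
    (simp (f zero) (f (suc (suc c)) - t * f (suc (inject₁ c))))
    where
    simp : ∀ x y → x * 0ℤ + y ≡ y
    simp = solve-∀

  powers : ∀ {n m} → (Fin n → ℤ) → Rows n m
  powers α i r = α i ^ toℕ r

  -- The product of `α j - α i` over i < j, arranged by the smaller index so as to follow the
  -- induction on the determinant.
  vandermonde : ∀ {n} → (Fin n → ℤ) → ℤ
  vandermonde {zero}  α = 1ℤ
  vandermonde {suc n} α = ∏ (λ j → α (suc j) - α zero) * vandermonde (α ∘ suc)

  module _ {n} (α : Fin (suc n) → ℤ) where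
    private
      sheared : Matrix (suc n)
      sheared = powers α · shear (α zero)

      sheared-zero : ∀ i → sheared i zero ≡ 1ℤ
      sheared-zero i = ∑-shear-zero {n} (α zero) (powers α i)

      sheared-suc : ∀ i c → sheared i (suc c) ≡ (α i - α zero) * α i ^ toℕ c
      sheared-suc i c = begin
        sheared i (suc c)
          ≡⟨ ∑-shear-suc (α zero) (powers α i) c ⟩
        α i * α i ^ toℕ c - α zero * α i ^ toℕ (inject₁ c)
          ≡⟨ cong (λ r → α i * α i ^ toℕ c - α zero * α i ^ r) (toℕ-inject₁ c) ⟩
        α i * α i ^ toℕ c - α zero * α i ^ toℕ c
          ≡⟨ factor (α i) (α zero) (α i ^ toℕ c) ⟩
        (α i - α zero) * α i ^ toℕ c ∎
        where
        factor : ∀ a b x → a * x - b * x ≡ (a - b) * x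
        factor = solve-∀

      sheared-corner : ∀ c → sheared zero (suc c) ≡ 0ℤ
      sheared-corner c = trans (sheared-suc zero c) (vanish (α zero) (α zero ^ toℕ c))
        where
        vanish : ∀ a x → (a - a) * x ≡ 0ℤ
        vanish = solve-∀

      differences : Fin n → ℤ
      differences j = α (suc j) - α zero

    -- Subtracting `α zero` times each column from the next turns the top row into (1, 0, ..., 0)
    -- and gives every other row the common factor `α i - α zero` beyond its first entry. Shearing
    -- has determinant 1.
    det-powers-step : det (powers {m = suc n} α) ≡ ∏ differences * det (powers {m = n} (α ∘ suc))
    det-powers-step = begin
      det (powers α)                          ≡⟨ ℤP.*-identityʳ _ ⟨
      det (powers α) * 1ℤ                     ≡⟨ cong (det (powers {m = suc n} α) *_) (det-shear {suc n} (α zero)) ⟨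
      det (powers α) * det (shear {suc n} (α zero)) ≡⟨ det-· (powers α) (shear (α zero)) ⟨
      det sheared                             ≡⟨ det-block-lower sheared sheared-corner ⟩
      sheared zero zero * det (λ r c → sheared (suc r) (suc c))
        ≡⟨ cong₂ _*_ (sheared-zero zero) (det-cong λ r c → sheared-suc (suc r) c) ⟩
      1ℤ * det (λ r c → differences r * α (suc r) ^ toℕ c)
        ≡⟨ ℤP.*-identityˡ _ ⟩
      det (λ r c → differences r * α (suc r) ^ toℕ c)
        ≡⟨ det-scale-rows differences (powers (α ∘ suc)) ⟩
      ∏ differences * det (powers (α ∘ suc))  ∎

    -- The mirror image, with row operations from the left; it takes the place of invariance under
    -- transposition.
    det-powersᵀ-step : det (flip (powers {m = suc n} α)) ≡
                       ∏ differences * det (flip (powers {m = n} (α ∘ suc)))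
    det-powersᵀ-step = begin
      det (flip (powers α))                   ≡⟨ ℤP.*-identityˡ _ ⟨
      1ℤ * det (flip (powers α))
        ≡⟨ cong (_* det (flip (powers {m = suc n} α))) (det-shearᵀ {suc n} (α zero)) ⟨
      det (flip (shear {suc n} (α zero))) * det (flip (powers α))
        ≡⟨ det-· (flip (shear (α zero))) (flip (powers α)) ⟨
      det (flip (shear (α zero)) · flip (powers α))
        ≡⟨ det-cong (λ r c → ∑-cong λ k → ℤP.*-comm (shear (α zero) k r) (powers α c k)) ⟩
      det (flip sheared)                      ≡⟨ det-block-upper (flip sheared) sheared-corner ⟩
      sheared zero zero * det (λ r c → sheared (suc c) (suc r))
        ≡⟨ cong₂ _*_ (sheared-zero zero) (det-cong λ r c → sheared-suc (suc c) r) ⟩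
      1ℤ * det (λ r c → differences c * α (suc c) ^ toℕ r)
        ≡⟨ ℤP.*-identityˡ _ ⟩
      det (λ r c → differences c * α (suc c) ^ toℕ r)
        ≡⟨ det-scale-columns differences (flip (powers (α ∘ suc))) ⟩
      ∏ differences * det (flip (powers (α ∘ suc)))  ∎

  det-powers : ∀ {n} (α : Fin n → ℤ) → det (powers α) ≡ vandermonde α
  det-powers {zero}  α = refl
  det-powers {suc n} α = trans (det-powers-step α)
    (cong (∏ (λ j → α (suc j) - α zero) *_) (det-powers (α ∘ suc)))

  det-powersᵀ : ∀ {n} (α : Fin n → ℤ) → det (flip (powers α)) ≡ vandermonde α
  det-powersᵀ {zero}  α = refl
  det-powersᵀ {suc n} α = trans (det-powersᵀ-step α)
    (cong (∏ (λ j → α (suc j) - α zero) *_) (det-powersᵀ (α ∘ suc)))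

  T-suc : ∀ {n} (α : Fin (suc n) → ℤ) → T α ≡ ∏ (λ j → α zero - α (suc j)) * T (α ∘ suc)
  T-suc α = cong₂ _*_ (ℤP.*-identityˡ (∏ λ j → α zero - α (suc j)))
    (ΠP.sum-cong-≗ λ i → ℤP.*-identityˡ (∏ λ j → if does (i <? j) then α (suc i) - α (suc j) else 1ℤ))

  ∏-square-cong : ∀ {n} {f g : Fin n → ℤ} → (∀ i → f i * f i ≡ g i * g i) → ∏ f * ∏ f ≡ ∏ g * ∏ g
  ∏-square-cong {zero} eq = refl
  ∏-square-cong {suc n} {f} {g} eq = begin
    f₀ * f₁ * (f₀ * f₁)   ≡⟨ interchange f₀ f₁ ⟩
    f₀ * f₀ * (f₁ * f₁)   ≡⟨ cong₂ _*_ (eq zero) (∏-square-cong {n} (eq ∘ suc)) ⟩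
    g₀ * g₀ * (g₁ * g₁)   ≡⟨ interchange g₀ g₁ ⟨
    g₀ * g₁ * (g₀ * g₁)   ∎
    where
    f₀ = f zero
    f₁ = ∏ (f ∘ suc)
    g₀ = g zero
    g₁ = ∏ (g ∘ suc)
    interchange : ∀ a b → a * b * (a * b) ≡ a * a * (b * b)
    interchange = solve-∀

  -- `T` is built from the opposite differences. Squaring removes the sign between the two products,
  -- so it never has to be computed.
  vandermonde² : ∀ {n} (α : Fin n → ℤ) → vandermonde α * vandermonde α ≡ T α * T α
  vandermonde² {zero}  α = refl
  vandermonde² {suc n} α = begin
    ∏ d * v * (∏ d * v)    ≡⟨ interchange (∏ d) v ⟩
    ∏ d * ∏ d * (v * v)    ≡⟨ cong₂ _*_ (∏-square-cong λ j → flip-sign (α zero) (α (suc j)))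
                                        (vandermonde² (α ∘ suc)) ⟩
    ∏ e * ∏ e * (t * t)    ≡⟨ interchange (∏ e) t ⟨
    ∏ e * t * (∏ e * t)    ≡⟨ cong (λ z → z * z) (T-suc α) ⟨
    T α * T α              ∎
    where
    v = vandermonde (α ∘ suc)
    t = T (α ∘ suc)
    d e : Fin n → ℤ
    d j = α (suc j) - α zero
    e j = α zero - α (suc j)
    interchange : ∀ a b → a * b * (a * b) ≡ a * a * (b * b)
    interchange = solve-∀
    flip-sign : ∀ x y → (y - x) * (y - x) ≡ (x - y) * (x - y)
    flip-sign = solve-∀

  -1^n*-1^n : ∀ n → -1ℤ ^ n * -1ℤ ^ n ≡ 1ℤ
  -1^n*-1^n zero    = refl
  -1^n*-1^n (suc n) = trans (cancel (-1ℤ ^ n)) (-1^n*-1^n n)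
    where
    cancel : ∀ x → -1ℤ * x * (-1ℤ * x) ≡ x * x
    cancel = solve-∀

  -- The coefficient matrix

  private
    punchIn-fromℕ : ∀ {n} (c : Fin n) → punchIn (fromℕ n) c ≡ inject₁ c
    punchIn-fromℕ zero    = refl
    punchIn-fromℕ (suc c) = cong suc (punchIn-fromℕ c)

    𝟙-inject₁ : ∀ {n m} (i : Fin n) (j : Fin m) → 𝟙 (inject₁ i) (inject₁ j) ≡ 𝟙 i j
    𝟙-inject₁ zero    zero    = refl
    𝟙-inject₁ zero    (suc _) = refl
    𝟙-inject₁ (suc _) zero    = refl
    𝟙-inject₁ (suc i) (suc j) = 𝟙-inject₁ i j

  -- The signs make the determinant the plain product of the e i.
  antidiagonal : ∀ {n} → (Fin n → ℤ) → Matrix n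
  antidiagonal e i j = 𝟙 (opposite i) j * (-1ℤ ^ toℕ j * e i)

  det-antidiagonal : ∀ {n} (e : Fin n → ℤ) → det (antidiagonal e) ≡ ∏ e
  det-antidiagonal {zero}  e = refl
  det-antidiagonal {suc n} e = begin
    det (antidiagonal e)
      ≡⟨ ∑-cong (λ j → regroup (-1ℤ ^ toℕ j) (𝟙 (fromℕ n) j) (e zero) (minor j)) ⟩
    ∑ (λ j → 𝟙 (fromℕ n) j * (-1ℤ ^ toℕ j * -1ℤ ^ toℕ j * (e zero * minor j)))
      ≡⟨ ∑-𝟙 (fromℕ n) (λ j → -1ℤ ^ toℕ j * -1ℤ ^ toℕ j * (e zero * minor j)) ⟩
    -1ℤ ^ toℕ (fromℕ n) * -1ℤ ^ toℕ (fromℕ n) * (e zero * minor (fromℕ n))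
      ≡⟨ cong₂ (λ x y → x * (e zero * y)) (-1^n*-1^n (toℕ (fromℕ n))) minor-last ⟩
    1ℤ * (e zero * ∏ (e ∘ suc))
      ≡⟨ ℤP.*-identityˡ _ ⟩
    e zero * ∏ (e ∘ suc) ∎
    where
    minor : Fin (suc n) → ℤ
    minor j = det λ r c → antidiagonal e (suc r) (punchIn j c)
    regroup : ∀ s d e m → s * (d * (s * e)) * m ≡ d * (s * s * (e * m))
    regroup = solve-∀
    minor-last : minor (fromℕ n) ≡ ∏ (e ∘ suc)
    minor-last = trans
      (det-cong λ r c → begin
        𝟙 (inject₁ (opposite r)) (punchIn (fromℕ n) c) * (-1ℤ ^ toℕ (punchIn (fromℕ n) c) * e (suc r))
          ≡⟨ cong (λ j → 𝟙 (inject₁ (opposite r)) j * (-1ℤ ^ toℕ j * e (suc r))) (punchIn-fromℕ c) ⟩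
        𝟙 (inject₁ (opposite r)) (inject₁ c) * (-1ℤ ^ toℕ (inject₁ c) * e (suc r))
          ≡⟨ cong₂ (λ d k → d * (-1ℤ ^ k * e (suc r))) (𝟙-inject₁ (opposite r) c) (toℕ-inject₁ c) ⟩
        𝟙 (opposite r) c * (-1ℤ ^ toℕ c * e (suc r)) ∎)
      (det-antidiagonal (e ∘ suc))

  -- Row and column indices are the exponents of x and y. Exponents 0 and 1 form the block of
  -- `a * (x - y)`; the others meet on the antidiagonal, where the two exponents add up to n + 3.
  skewCoefficients : ∀ {n} → ℤ → (Fin n → ℤ) → Matrix (2 ℕ.+ n)
  skewCoefficients a e zero          zero          = 0ℤ
  skewCoefficients a e zero          (suc zero)    = - a
  skewCoefficients a e zero          (suc (suc _)) = 0ℤ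
  skewCoefficients a e (suc zero)    zero          = a
  skewCoefficients a e (suc zero)    (suc _)       = 0ℤ
  skewCoefficients a e (suc (suc _)) zero          = 0ℤ
  skewCoefficients a e (suc (suc _)) (suc zero)    = 0ℤ
  skewCoefficients a e (suc (suc i)) (suc (suc j)) = antidiagonal e i j

  det-skewCoefficients : ∀ {n} a (e : Fin n → ℤ) → det (skewCoefficients a e) ≡ a * a * ∏ e
  det-skewCoefficients {n} a e = begin
    1ℤ * 0ℤ * minor zero + (-1ℤ * 1ℤ * - a * minor (suc zero) + ∑ later)
      ≡⟨ cong₂ (λ x y → 1ℤ * 0ℤ * minor zero + (-1ℤ * 1ℤ * - a * x + y)) minor-one later-zero ⟩
    1ℤ * 0ℤ * minor zero + (-1ℤ * 1ℤ * - a * (a * ∏ e) + 0ℤ)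
      ≡⟨ simp a (∏ e) (minor zero) ⟩
    a * a * ∏ e ∎
    where
    K = skewCoefficients a e
    minor : Fin (2 ℕ.+ n) → ℤ
    minor j = det λ r c → K (suc r) (punchIn j c)
    later : Fin n → ℤ
    later j = -1ℤ ^ (2 ℕ.+ toℕ j) * 0ℤ * minor (suc (suc j))
    later-zero : ∑ later ≡ 0ℤ
    later-zero = ∑-zero λ j → vanish (-1ℤ ^ (2 ℕ.+ toℕ j)) (minor (suc (suc j)))
      where
      vanish : ∀ s m → s * 0ℤ * m ≡ 0ℤ
      vanish = solve-∀
    minor-one : minor (suc zero) ≡ a * ∏ e
    minor-one = trans
      (det-block-lower (λ r c → K (suc r) (punchIn (suc zero) c)) λ _ → refl)
      (cong (a *_) (det-antidiagonal e))
    simp : ∀ a x m → 1ℤ * 0ℤ * m + (-1ℤ * 1ℤ * - a * (a * x) + 0ℤ) ≡ a * a * x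
    simp = solve-∀

  skewCoefficients-form : ∀ {n} a (e : Fin n → ℤ) (x y : Fin (2 ℕ.+ n) → ℤ) →
    ∑ (λ r → x r * ∑ λ t → skewCoefficients a e r t * y t) ≡
    a * (x (suc zero) * y zero - x zero * y (suc zero)) +
    ∑ λ i → x (suc (suc i)) * (-1ℤ ^ toℕ (opposite i) * e i * y (suc (suc (opposite i))))
  skewCoefficients-form {n} a e x y = begin
    x₀ * (0ℤ * y₀ + (- a * y₁ + ∑ {n} λ t → 0ℤ * y (suc (suc t))))
      + (x₁ * (a * y₀ + (0ℤ * y₁ + ∑ {n} λ t → 0ℤ * y (suc (suc t))))
      + ∑ λ i → x (suc (suc i)) * (0ℤ * y₀ + (0ℤ * y₁ + ∑ λ t → antidiagonal e i t * y (suc (suc t)))))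
      ≡⟨ cong₂ (λ u v → x₀ * (0ℤ * y₀ + (- a * y₁ + u)) + (x₁ * (a * y₀ + (0ℤ * y₁ + u)) + v))
           (∑-zero {n} λ t → ℤP.*-zeroˡ (y (suc (suc t)))) (∑-cong inner) ⟩
    x₀ * (0ℤ * y₀ + (- a * y₁ + 0ℤ)) + (x₁ * (a * y₀ + (0ℤ * y₁ + 0ℤ)) + ∑ rest)
      ≡⟨ simp a x₀ x₁ y₀ y₁ (∑ rest) ⟩
    a * (x₁ * y₀ - x₀ * y₁) + ∑ rest ∎
    where
    x₀ = x zero
    x₁ = x (suc zero)
    y₀ = y zero
    y₁ = y (suc zero)
    rest : Fin n → ℤ
    rest i = x (suc (suc i)) * (-1ℤ ^ toℕ (opposite i) * e i * y (suc (suc (opposite i))))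
    simp : ∀ a x₀ x₁ y₀ y₁ r →
      x₀ * (0ℤ * y₀ + (- a * y₁ + 0ℤ)) + (x₁ * (a * y₀ + (0ℤ * y₁ + 0ℤ)) + r) ≡
      a * (x₁ * y₀ - x₀ * y₁) + r
    simp = solve-∀
    drop : ∀ y₀ y₁ r → 0ℤ * y₀ + (0ℤ * y₁ + r) ≡ r
    drop = solve-∀
    inner : ∀ i → x (suc (suc i)) * (0ℤ * y₀ + (0ℤ * y₁ + ∑ λ t → antidiagonal e i t * y (suc (suc t))))
                ≡ rest i
    inner i = cong (x (suc (suc i)) *_) (begin
      0ℤ * y₀ + (0ℤ * y₁ + ∑ λ t → antidiagonal e i t * y (suc (suc t)))
        ≡⟨ drop y₀ y₁ (∑ λ t → antidiagonal e i t * y (suc (suc t))) ⟩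
      ∑ (λ t → antidiagonal e i t * y (suc (suc t)))
        ≡⟨ ∑-cong (λ t → ℤP.*-assoc (𝟙 (opposite i) t) (-1ℤ ^ toℕ t * e i) (y (suc (suc t)))) ⟩
      ∑ (λ t → 𝟙 (opposite i) t * (-1ℤ ^ toℕ t * e i * y (suc (suc t))))
        ≡⟨ ∑-𝟙 (opposite i) (λ t → -1ℤ ^ toℕ t * e i * y (suc (suc t))) ⟩
      -1ℤ ^ toℕ (opposite i) * e i * y (suc (suc (opposite i))) ∎)

-- The binomial theorem over the integers

private
  module ℤBinomial = Binomial (CommutativeRing.commutativeSemiring +-*-commutativeRing)
  module ℤ+ = RawMonoid (Semiring.+-rawMonoid (CommutativeRing.semiring +-*-commutativeRing))
  module ℤ* = RawMonoid (Semiring.*-rawMonoid (CommutativeRing.semiring +-*-commutativeRing))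

binomial-theorem : ∀ n x y → (x + y) ^ n ≡
  ∑ {suc n} λ r → + (n C toℕ r) * (x ^ toℕ r * y ^ (n ℕ.∸ toℕ r))
binomial-theorem n x y = trans (sym (^-iterated n (x + y))) (trans (ℤBinomial.theorem n x y)
  (∑-cong {suc n} {ℤBinomial.binomialTerm x y n} λ r → trans (×-multiple (n C toℕ r) (ℤBinomial.binomial x y n r))
    (cong₂ (λ u v → + (n C toℕ r) * (u * v)) (^-iterated (toℕ r) x)
      (^-iterated (n ℕ.∸ toℕ r) y))))
  where
  ^-iterated : ∀ n x → n ℤ*.× x ≡ x ^ n
  ^-iterated zero    x = refl
  ^-iterated (suc n) x = cong (x *_) (^-iterated n x)
  ×-multiple : ∀ n x → n ℤ+.× x ≡ + n * x
  ×-multiple zero    x = sym (ℤP.*-zeroˡ x)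
  ×-multiple (suc n) x = trans (cong (λ z → x + z) (×-multiple n x)) (sym (ℤP.suc-* (+ n) x))

nCk*k![n∸k]!≡n! : ∀ {n k} → k ℕ.≤ n → (n C k) ℕ.* (k ! ℕ.* (n ℕ.∸ k) !) ≡ n !
nCk*k![n∸k]!≡n! {n} {k} k≤n = trans
  (cong (ℕ._* (k ! ℕ.* (n ℕ.∸ k) !)) (nCk≡n!/k![n-k]! k≤n))
  (m/n*n≡m (k![n∸k]!∣n! k≤n))
  where instance _ = k ℕP.!* (n ℕ.∸ k) !≢0

-- Congruences and the Legendre symbol

module Modular (n : ℕ) where

  -- A record around the congruence, so that its two sides can be inferred.
  infix 4 _≋_
  record _≋_ (a b : ℤ) : Set where
    constructor mod
    field unmod : a ≡ b [mod n ]
  open _≋_ public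

  ≋-reflexive : ∀ {a b} → a ≡ b → a ≋ b
  ≋-reflexive {a} refl = mod (subst (+ n ℤ∣.∣_) (sym (ℤP.+-inverseʳ a)) (ℤ∣.divides 0ℤ refl))

  ≋-refl : ∀ {a} → a ≋ a
  ≋-refl = ≋-reflexive refl

  ≋-sym : ∀ {a b} → a ≋ b → b ≋ a
  ≋-sym {a} {b} (mod d) = mod (subst (+ n ℤ∣.∣_) (negate a b) (ℤ∣.∣m⇒∣-m d))
    where
    negate : ∀ a b → - (a - b) ≡ b - a
    negate = solve-∀

  ≋-trans : ∀ {a b c} → a ≋ b → b ≋ c → a ≋ c
  ≋-trans {a} {b} {c} (mod d) (mod e) =
    mod (subst (+ n ℤ∣.∣_) (telescope a b c) (ℤ∣.∣m∣n⇒∣m+n d e))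
    where
    telescope : ∀ a b c → (a - b) + (b - c) ≡ a - c
    telescope = solve-∀

  ≋-setoid : Setoid _ _
  ≋-setoid = record
    { Carrier = ℤ ; _≈_ = _≋_
    ; isEquivalence = record { refl = ≋-refl ; sym = ≋-sym ; trans = ≋-trans } }

  module ≋-Reasoning = SetoidReasoning ≋-setoid
  open ≋-Reasoning

  +-cong : ∀ {a b c d} → a ≋ b → c ≋ d → a + c ≋ b + d
  +-cong {a} {b} {c} {d} (mod e) (mod f) =
    mod (subst (+ n ℤ∣.∣_) (regroup a b c d) (ℤ∣.∣m∣n⇒∣m+n e f))
    where
    regroup : ∀ a b c d → (a - b) + (c - d) ≡ (a + c) - (b + d)
    regroup = solve-∀

  *-cong : ∀ {a b c d} → a ≋ b → c ≋ d → a * c ≋ b * d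
  *-cong {a} {b} {c} {d} (mod e) (mod f) =
    mod (subst (+ n ℤ∣.∣_) (regroup a b c d) (ℤ∣.∣m∣n⇒∣m+n (ℤ∣.∣m⇒∣m*n c e) (ℤ∣.∣n⇒∣m*n b f)))
    where
    regroup : ∀ a b c d → (a - b) * c + b * (c - d) ≡ a * c - b * d
    regroup = solve-∀

  *-congˡ : ∀ a {b c} → b ≋ c → a * b ≋ a * c
  *-congˡ a = *-cong (≋-refl {a})

  *-congʳ : ∀ {a b} c → a ≋ b → a * c ≋ b * c
  *-congʳ c a≋b = *-cong a≋b (≋-refl {c})

  ^-cong : ∀ {a b} k → a ≋ b → a ^ k ≋ b ^ k
  ^-cong zero    a≋b = ≋-refl
  ^-cong (suc k) a≋b = *-cong a≋b (^-cong k a≋b)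

  ∑-≋ : ∀ {m} {f g : Fin m → ℤ} → (∀ i → f i ≋ g i) → ∑ f ≋ ∑ g
  ∑-≋ {zero}  eq = ≋-refl
  ∑-≋ {suc m} eq = +-cong (eq zero) (∑-≋ (λ i → eq (suc i)))

  det-≋ : ∀ {m} {A B : Matrix m} → (∀ i j → A i j ≋ B i j) → det A ≋ det B
  det-≋ {zero}  eq = ≋-refl
  det-≋ {suc m} eq = ∑-≋ λ j →
    *-cong (*-congˡ (-1ℤ ^ toℕ j) (eq zero j)) (det-≋ λ r c → eq (suc r) (punchIn j c))

  ≋0⇒∣ : ∀ {a} → a ≋ 0ℤ → + n ℤ∣.∣ a
  ≋0⇒∣ {a} (mod d) = subst (+ n ℤ∣.∣_) (ℤP.+-identityʳ a) d

  ∣⇒≋0 : ∀ {a} → + n ℤ∣.∣ a → a ≋ 0ℤ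
  ∣⇒≋0 {a} d = mod (subst (+ n ℤ∣.∣_) (sym (ℤP.+-identityʳ a)) d)

  n≋0 : + n ≋ 0ℤ
  n≋0 = ∣⇒≋0 ℤ∣.∣-refl

  ≋0⇒∣ℕ : ∀ {a} → + a ≋ 0ℤ → n ℕ∣.∣ a
  ≋0⇒∣ℕ a≋0 = ℤ∣.∣⇒∣ᵤ (≋0⇒∣ a≋0)

  ∣ℕ⇒≋0 : ∀ {a} → n ℕ∣.∣ a → + a ≋ 0ℤ
  ∣ℕ⇒≋0 d = ∣⇒≋0 (ℤ∣.∣ᵤ⇒∣ d)

  difference⇒≋ : ∀ {a b} → a - b ≋ 0ℤ → a ≋ b
  difference⇒≋ d = mod (≋0⇒∣ d)

  ≋⇒difference : ∀ {a b} → a ≋ b → a - b ≋ 0ℤ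
  ≋⇒difference (mod d) = ∣⇒≋0 d

  0<a<n⇒≋̸0 : ∀ {a} → 0 ℕ.< a → a ℕ.< n → ¬ (+ a ≋ 0ℤ)
  0<a<n⇒≋̸0 0<a a<n a≋0 = ℕP.<⇒≱ a<n (ℕ∣.∣⇒≤ {{ℕ.>-nonZero 0<a}} (≋0⇒∣ℕ a≋0))

  small-≋⇒≡ : ∀ {a b} → a ℕ.< n → b ℕ.< n → + a ≋ + b → a ≡ b
  small-≋⇒≡ {a} {b} a<n b<n a≋b =
    [ (λ a≤b → sym (ordered a≤b b<n (≋-sym a≋b))) , (λ b≤a → ordered b≤a a<n a≋b) ]′ (ℕP.≤-total a b)
    where
    cancel : ∀ x y → (x + y) - x ≡ y
    cancel = solve-∀
    ordered : ∀ {x y} → x ℕ.≤ y → y ℕ.< n → + y ≋ + x → y ≡ x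
    ordered {x} {y} x≤y y<n y≋x with y ℕ.∸ x in eq
    ... | zero  = ℕP.≤-antisym (ℕP.m∸n≡0⇒m≤n eq) x≤y
    ... | suc d = ⊥-elim (0<a<n⇒≋̸0 (s≤s (z≤n {d})) (ℕP.≤-<-trans (subst (ℕ._≤ y) eq (ℕP.m∸n≤m y x)) y<n) (begin
      + suc d                ≡⟨ cancel (+ x) (+ suc d) ⟨
      + (x ℕ.+ suc d) - + x  ≡⟨ cong (λ z → + (x ℕ.+ z) - + x) eq ⟨
      + (x ℕ.+ (y ℕ.∸ x)) - + x ≡⟨ cong (λ z → + z - + x) (ℕP.m+[n∸m]≡n x≤y) ⟩
      + y - + x              ≈⟨ ≋⇒difference y≋x ⟩
      0ℤ                     ∎))

  module _ .{{_ : NonZero n}} where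

    residue : ℤ → Fin n
    residue a = fromℕ< (n%ℕd<d a n)

    residue-≋ : ∀ a → + toℕ (residue a) ≋ a
    residue-≋ a = begin
      + toℕ (residue a)             ≡⟨ cong +_ (toℕ-fromℕ< (n%ℕd<d a n)) ⟩
      + (a %ℕ n)                    ≡⟨ ℤP.+-identityʳ _ ⟨
      + (a %ℕ n) + 0ℤ               ≡⟨ cong (λ z → + (a %ℕ n) + z) (ℤP.*-zeroʳ (a /ℕ n)) ⟨
      + (a %ℕ n) + (a /ℕ n) * 0ℤ    ≈⟨ +-cong (≋-refl {+ (a %ℕ n)}) (*-congˡ (a /ℕ n) n≋0) ⟨
      + (a %ℕ n) + (a /ℕ n) * + n   ≡⟨ a≡a%ℕn+[a/ℕn]*n a n ⟨
      a                             ∎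

  infix 4 _≋?_
  abstract
    _≋?_ : ∀ a b → Dec (a ≋ b)
    a ≋? b = map′ mod unmod (a ≡? b [mod n ])

-- Prime moduli and Fermat's little theorem

module PrimeModulus (p : ℕ) (p-prime : Prime p) where
  open Modular p public
  open ≋-Reasoning

  instance
    p≢0 : NonZero p
    p≢0 = prime⇒nonZero p-prime

  1<p : 1 ℕ.< p
  1<p = ℕ.nonTrivial⇒n>1 p {{prime⇒nonTrivial p-prime}}

  1≋̸0 : ¬ (1ℤ ≋ 0ℤ)
  1≋̸0 = 0<a<n⇒≋̸0 (s≤s z≤n) 1<p

  euclid : ∀ a b → a * b ≋ 0ℤ → a ≋ 0ℤ ⊎ b ≋ 0ℤ
  euclid a b ab≋0 = Sum.map (∣⇒≋0 ∘ ℤ∣.∣ᵤ⇒∣) (∣⇒≋0 ∘ ℤ∣.∣ᵤ⇒∣)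
    (euclidsLemma ℤ.∣ a ∣ ℤ.∣ b ∣ p-prime
      (subst (p ℕ∣.∣_) (ℤP.abs-* a b) (ℤ∣.∣⇒∣ᵤ (≋0⇒∣ ab≋0))))

  *-≋̸0 : ∀ {a b} → ¬ (a ≋ 0ℤ) → ¬ (b ≋ 0ℤ) → ¬ (a * b ≋ 0ℤ)
  *-≋̸0 {a} {b} a≋̸0 b≋̸0 = [ a≋̸0 , b≋̸0 ]′ ∘ euclid a b

  *-cancelˡ : ∀ c {a b} → ¬ (c ≋ 0ℤ) → c * a ≋ c * b → a ≋ b
  *-cancelˡ c {a} {b} c≋̸0 eq = [ ⊥-elim ∘ c≋̸0 , difference⇒≋ ]′ (euclid c (a - b) (begin
    c * (a - b)     ≡⟨ distribute c a b ⟩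
    c * a - c * b   ≈⟨ ≋⇒difference eq ⟩
    0ℤ              ∎))
    where
    distribute : ∀ c a b → c * (a - b) ≡ c * a - c * b
    distribute = solve-∀

  square-≋⇒± : ∀ a b → a * a ≋ b * b → a ≋ b ⊎ a ≋ - b
  square-≋⇒± a b eq = Sum.map difference⇒≋ (λ s → difference⇒≋ (≋-trans (≋-reflexive (double a b)) s))
    (euclid (a - b) (a + b) (≋-trans (≋-reflexive (factor a b)) (≋⇒difference eq)))
    where
    factor : ∀ a b → (a - b) * (a + b) ≡ a * a - b * b
    factor = solve-∀
    double : ∀ a b → a - - b ≡ a + b
    double = solve-∀

  ∏-≋̸0 : ∀ {m} {f : Fin m → ℤ} → (∀ i → ¬ (f i ≋ 0ℤ)) → ¬ (∏ f ≋ 0ℤ)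
  ∏-≋̸0 {zero}  f≋̸0 = 1≋̸0
  ∏-≋̸0 {suc m} f≋̸0 = *-≋̸0 (f≋̸0 zero) (∏-≋̸0 {m} (f≋̸0 ∘ suc))

  !-≋̸0 : ∀ {r} → r ℕ.< p → ¬ (+ (r !) ≋ 0ℤ)
  !-≋̸0 {zero}  _   = 1≋̸0
  !-≋̸0 {suc r} r<p = subst (λ z → ¬ (z ≋ 0ℤ)) (sym (ℤP.pos-* (suc r) (r !)))
    (*-≋̸0 (0<a<n⇒≋̸0 (s≤s z≤n) r<p) (!-≋̸0 (ℕP.<-trans (ℕP.n<1+n r) r<p)))

  -- `p` divides `p !` but neither of the factorials in the denominator.
  p∣pCr : ∀ {r} → 0 ℕ.< r → r ℕ.< p → + (p C r) ≋ 0ℤ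
  p∣pCr {r} 0<r r<p with euclid (+ (p C r)) (+ (r ! ℕ.* (p ℕ.∸ r) !)) (begin
      + (p C r) * + (r ! ℕ.* (p ℕ.∸ r) !)    ≡⟨ ℤP.pos-* (p C r) _ ⟨
      + ((p C r) ℕ.* (r ! ℕ.* (p ℕ.∸ r) !))  ≡⟨ cong +_ (nCk*k![n∸k]!≡n! (ℕP.<⇒≤ r<p)) ⟩
      + (p !)                                ≈⟨ ∣ℕ⇒≋0 (p∣p! p) ⟩
      0ℤ                                     ∎)
    where
    p∣p! : ∀ p .{{_ : NonZero p}} → p ℕ∣.∣ p !
    p∣p! (suc q) = ℕ∣.m∣m*n (q !)
  ... | inj₁ C≋0 = C≋0
  ... | inj₂ ff≋0 = ⊥-elim (*-≋̸0 (!-≋̸0 r<p) (!-≋̸0 (ℕP.∸-monoʳ-< 0<r (ℕP.<⇒≤ r<p)))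
                      (≋-trans (≋-reflexive (sym (ℤP.pos-* (r !) _))) ff≋0))

  frobenius : ∀ x → (x + 1ℤ) ^ p ≋ x ^ p + 1ℤ
  frobenius x = step p refl
    where
    -- Stating the claim for a variable `q` allows `p` to be matched as a successor, which splits
    -- off the first term of the expansion.
    step : ∀ q → q ≡ p → (x + 1ℤ) ^ q ≋ x ^ q + 1ℤ
    step zero    q≡p = ⊥-elim (ℕP.<⇒≢ (ℕP.<-trans (s≤s z≤n) 1<p) q≡p)
    step (suc q) refl = begin
      (x + 1ℤ) ^ suc q
        ≡⟨ binomial-theorem (suc q) x 1ℤ ⟩
      term zero + ∑ (term ∘ suc)
        ≡⟨ cong (λ z → term zero + z) (ΣP.sum-init-last (term ∘ suc)) ⟩
      term zero + (∑ (term ∘ suc ∘ inject₁) + term (suc (fromℕ q)))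
        ≡⟨ cong₂ (λ u v → u + (∑ (term ∘ suc ∘ inject₁) + v)) first last ⟩
      1ℤ + (∑ (term ∘ suc ∘ inject₁) + x ^ suc q)
        ≈⟨ +-cong (≋-refl {1ℤ}) (+-cong (≋-trans (∑-≋ middle) (≋-reflexive (∑-zero {q} λ _ → refl))) ≋-refl) ⟩
      1ℤ + (0ℤ + x ^ suc q)
        ≡⟨ rearrange (x ^ suc q) ⟩
      x ^ suc q + 1ℤ ∎
      where
      term : Fin (2 ℕ.+ q) → ℤ
      term r = + (suc q C toℕ r) * (x ^ toℕ r * 1ℤ ^ (suc q ℕ.∸ toℕ r))
      first : term zero ≡ 1ℤ
      first = cong₂ (λ c z → + c * (1ℤ * z)) (n!/n! (suc q)) (ℤP.^-zeroˡ (suc q))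
        where
        n!/n! : ∀ n → n C 0 ≡ 1
        n!/n! n = ℕP.*-cancelʳ-≡ (n C 0) 1 (1 ℕ.* n !) {{subst NonZero (sym (ℕP.*-identityˡ (n !))) (n ℕP.!≢0)}}
          (trans (nCk*k![n∸k]!≡n! {n} {0} z≤n) (sym (trans (ℕP.*-identityˡ _) (ℕP.*-identityˡ _))))
      last : term (suc (fromℕ q)) ≡ x ^ suc q
      last = trans (cong (λ r → + (suc q C suc r) * (x ^ suc r * 1ℤ ^ (q ℕ.∸ r))) (toℕ-fromℕ q))
        (trans (cong₂ (λ c z → + c * (x ^ suc q * z)) (nCn≡1 (suc q)) (ℤP.^-zeroˡ (q ℕ.∸ q)))
          (simp (x ^ suc q)))
        where
        simp : ∀ y → 1ℤ * (y * 1ℤ) ≡ y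
        simp = solve-∀
      middle : ∀ i → term (suc (inject₁ i)) ≋ 0ℤ
      middle i = begin
        + (suc q C suc (toℕ (inject₁ i))) * z
          ≈⟨ *-congʳ z (p∣pCr (s≤s z≤n) (s≤s (subst (ℕ._< q) (sym (toℕ-inject₁ i)) (toℕ<n i)))) ⟩
        0ℤ * z ≡⟨ ℤP.*-zeroˡ z ⟩
        0ℤ ∎
        where z = x ^ suc (toℕ (inject₁ i)) * 1ℤ ^ (suc q ℕ.∸ suc (toℕ (inject₁ i)))
      rearrange : ∀ y → 1ℤ + (0ℤ + y) ≡ y + 1ℤ
      rearrange = solve-∀

  -- Additivity of the p-th power carries the congruence from a to a + 1, and reduction modulo `p`
  -- makes every integer a natural number.
  fermat : ∀ x → x ^ p ≋ x
  fermat x = begin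
    x ^ p                       ≈⟨ ^-cong p (residue-≋ x) ⟨
    (+ toℕ (residue x)) ^ p     ≈⟨ natural (toℕ (residue x)) ⟩
    + toℕ (residue x)           ≈⟨ residue-≋ x ⟩
    x                           ∎
    where
    natural : ∀ a → (+ a) ^ p ≋ + a
    natural zero    = ≋-reflexive (zero-power p)
      where
      zero-power : ∀ q .{{_ : NonZero q}} → 0ℤ ^ q ≡ 0ℤ
      zero-power (suc q) = ℤP.*-zeroˡ (0ℤ ^ q)
    natural (suc a) = begin
      (+ suc a) ^ p     ≡⟨ cong (_^ p) (successor a) ⟩
      (+ a + 1ℤ) ^ p    ≈⟨ frobenius (+ a) ⟩
      (+ a) ^ p + 1ℤ    ≈⟨ +-cong (natural a) ≋-refl ⟩
      + a + 1ℤ          ≡⟨ successor a ⟨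
      + suc a           ∎
      where
      successor : ∀ a → + suc a ≡ + a + 1ℤ
      successor a = cong +_ (ℕP.+-comm 1 a)

  fermat-unit : ∀ {x} → ¬ (x ≋ 0ℤ) → x ^ ℕ.pred p ≋ 1ℤ
  fermat-unit {x} x≋̸0 = *-cancelˡ x x≋̸0 (begin
    x ^ suc (ℕ.pred p)  ≡⟨ cong (x ^_) (ℕP.suc-pred p) ⟩
    x ^ p               ≈⟨ fermat x ⟩
    x                   ≡⟨ ℤP.*-identityʳ x ⟨
    x * 1ℤ              ∎)

  abstract
    inverse : ∀ {x} → ¬ (x ≋ 0ℤ) → ∃ λ y → y * x ≋ 1ℤ
    inverse {x} x≋̸0 = x ^ ℕ.pred (ℕ.pred p) , (begin
      x ^ ℕ.pred (ℕ.pred p) * x  ≡⟨ ℤP.*-comm _ x ⟩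
      x ^ suc (ℕ.pred (ℕ.pred p)) ≡⟨ cong (x ^_) (ℕP.suc-pred (ℕ.pred p) {{ℕ.>-nonZero (ℕP.pred-mono-< 1<p)}}) ⟩
      x ^ ℕ.pred p               ≈⟨ fermat-unit x≋̸0 ⟩
      1ℤ                         ∎)

-- Multiplicativity of the Legendre symbol

module LegendreSymbol (p : ℕ) (p-prime : Prime p) (h : ℕ) (p≡1+2h : p ≡ suc (h ℕ.+ h)) where
  open PrimeModulus p p-prime public
  open ≋-Reasoning

  Square : ℤ → Set
  Square a = ∃ λ x → x * x ≋ a

  private
    ^2 : ∀ x → x ^ 2 ≡ x * x
    ^2 x = cong (x *_) (ℤP.*-identityʳ x)

    HasRoot : ℤ → Set
    HasRoot a = ∃ λ (x : Fin p) → (+ toℕ x) ^ 2 ≡ a [mod p ]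

    hasRoot? : ∀ a → Dec (HasRoot a)
    hasRoot? a = any? λ (x : Fin p) → (+ toℕ x) ^ 2 ≡? a [mod p ]

    hasRoot⇒square : ∀ {a} → HasRoot a → Square a
    hasRoot⇒square (x , eq) = + toℕ x , ≋-trans (≋-reflexive (sym (^2 (+ toℕ x)))) (mod eq)

    square⇒hasRoot : ∀ {a} → Square a → HasRoot a
    square⇒hasRoot {a} (x , eq) = residue x , unmod (begin
      (+ toℕ (residue x)) ^ 2 ≈⟨ ^-cong 2 (residue-≋ x) ⟩
      x ^ 2                   ≡⟨ ^2 x ⟩
      x * x                   ≈⟨ eq ⟩
      a                       ∎)

  abstract
    square? : ∀ a → Dec (Square a)
    square? a = map′ hasRoot⇒square square⇒hasRoot (hasRoot? a)

  -- Kept abstract, since the search for a root must not be unfolded.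
  abstract
    χ : ℤ → ℤ
    χ a = legendre a p

    χ≡legendre : ∀ a → χ a ≡ legendre a p
    χ≡legendre a = refl

    χ-zero : ∀ {a} → a ≋ 0ℤ → χ a ≡ 0ℤ
    χ-zero {a} a≋0 = cong (λ b → if b then 0ℤ else if does (hasRoot? a) then 1ℤ else -1ℤ)
      (dec-true (a ≡? 0ℤ [mod p ]) (unmod a≋0))

    χ-square : ∀ {a} → ¬ (a ≋ 0ℤ) → Square a → χ a ≡ 1ℤ
    χ-square {a} a≋̸0 sq = cong₂ (λ b c → if b then 0ℤ else if c then 1ℤ else -1ℤ)
      (dec-false (a ≡? 0ℤ [mod p ]) (λ a≡0 → a≋̸0 (mod a≡0)))
      (dec-true (hasRoot? a) (square⇒hasRoot sq))

    χ-nonsquare : ∀ {a} → ¬ Square a → χ a ≡ -1ℤ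
    χ-nonsquare {a} ¬sq = cong₂ (λ b c → if b then 0ℤ else if c then 1ℤ else -1ℤ)
      (dec-false (a ≡? 0ℤ [mod p ]) (λ a≡0 → ¬sq (0ℤ , ≋-sym (mod a≡0))))
      (dec-false (hasRoot? a) (λ r → ¬sq (hasRoot⇒square r)))

  square-cong : ∀ {a b} → a ≋ b → Square a → Square b
  square-cong a≋b (x , eq) = x , ≋-trans eq a≋b

  χ-cong : ∀ {a b} → a ≋ b → χ a ≡ χ b
  χ-cong {a} {b} a≋b with a ≋? 0ℤ | square? a
  ... | yes a≋0 | _      = trans (χ-zero a≋0) (sym (χ-zero (≋-trans (≋-sym a≋b) a≋0)))
  ... | no a≋̸0 | yes sq  = trans (χ-square a≋̸0 sq)
    (sym (χ-square (a≋̸0 ∘ ≋-trans a≋b) (square-cong a≋b sq)))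
  ... | no _   | no ¬sq  = trans (χ-nonsquare ¬sq)
    (sym (χ-nonsquare (¬sq ∘ square-cong (≋-sym a≋b))))

  square-quotient : ∀ c {a b} → ¬ (c ≋ 0ℤ) → c * c * a ≋ b → Square b → Square a
  square-quotient c {a} {b} c≋̸0 eq (x , xx≋b) = d * x , (begin
    d * x * (d * x)          ≡⟨ interchange d x ⟩
    d * d * (x * x)          ≈⟨ *-congˡ (d * d) (≋-trans xx≋b (≋-sym eq)) ⟩
    d * d * (c * c * a)      ≡⟨ regroup d c a ⟩
    d * c * (d * c) * a      ≈⟨ *-congʳ a (*-cong dc≋1 dc≋1) ⟩
    1ℤ * 1ℤ * a              ≡⟨ ℤP.*-identityˡ a ⟩
    a                        ∎)
    where
    d = proj₁ (inverse c≋̸0)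
    dc≋1 = proj₂ (inverse c≋̸0)
    interchange : ∀ a b → a * b * (a * b) ≡ a * a * (b * b)
    interchange = solve-∀
    regroup : ∀ d c a → d * d * (c * c * a) ≡ d * c * (d * c) * a
    regroup = solve-∀

  private
    half<p : ∀ {x} → x ℕ.≤ h → x ℕ.< p
    half<p x≤h = subst (_ ℕ.<_) (sym p≡1+2h) (s≤s (ℕP.≤-trans x≤h (ℕP.m≤m+n h h)))

    -- If x ≡ -y, then x + y is a multiple of `p` that is at most 2h < p, so both numbers are 0.
    square-injective : ∀ x y → x ℕ.≤ h → y ℕ.≤ h → + x * + x ≋ + y * + y → x ≡ y
    square-injective x y x≤h y≤h eq with square-≋⇒± (+ x) (+ y) eq
    ... | inj₂ x≋-y = trans (ℕP.m+n≡0⇒m≡0 x x+y≡0) (sym (ℕP.m+n≡0⇒n≡0 x x+y≡0))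
      where
      x+y≋0 : + (x ℕ.+ y) ≋ 0ℤ
      x+y≋0 = begin
        + x + + y     ≈⟨ +-cong x≋-y ≋-refl ⟩
        - (+ y) + + y ≡⟨ ℤP.+-inverseˡ (+ y) ⟩
        0ℤ            ∎
      x+y≡0 : x ℕ.+ y ≡ 0
      x+y≡0 with x ℕ.+ y in eq
      ... | zero  = refl
      ... | suc s = ⊥-elim (0<a<n⇒≋̸0 {x ℕ.+ y} (subst (0 ℕ.<_) (sym eq) (s≤s z≤n))
        (subst (x ℕ.+ y ℕ.<_) (sym p≡1+2h) (s≤s (ℕP.+-mono-≤ x≤h y≤h))) x+y≋0)
    ... | inj₁ x≋y = small-≋⇒≡ (half<p x≤h) (half<p y≤h) x≋y

  private
    -- The classes of 0, of the squares, of a times the squares, and of b would be p + 1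
    -- distinct ones.
    module CosetCover {a b} (a≋̸0 : ¬ (a ≋ 0ℤ)) (a-nonsquare : ¬ Square a) (b-nonsquare : ¬ Square b)
      (b∉aQ : ∀ (j : Fin h) → ¬ (a * (+ suc (toℕ j) * + suc (toℕ j)) ≋ b)) where

      Index : Set
      Index = Fin (suc h) ⊎ Fin h ⊎ Fin 1

      value : Index → ℤ
      -- The squares are listed by 0, ..., h but the coset by 1, ..., h, since zero may be counted
      -- only once.
      value (inj₁ x)        = + toℕ x * + toℕ x
      value (inj₂ (inj₁ j)) = a * (+ suc (toℕ j) * + suc (toℕ j))
      value (inj₂ (inj₂ _)) = b

      suc-toℕ≋̸0 : ∀ (j : Fin h) → ¬ (+ suc (toℕ j) ≋ 0ℤ)
      suc-toℕ≋̸0 j = 0<a<n⇒≋̸0 (s≤s z≤n) (half<p (toℕ<n j))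

      square≢coset : ∀ x (j : Fin h) → ¬ (a * (+ suc (toℕ j) * + suc (toℕ j)) ≋ x * x)
      square≢coset x j eq = a-nonsquare (square-quotient (+ suc (toℕ j)) (suc-toℕ≋̸0 j)
        (≋-trans (≋-reflexive (ℤP.*-comm (+ suc (toℕ j) * + suc (toℕ j)) a)) eq) (x , ≋-refl))

      value-injective : ∀ u v → value u ≋ value v → u ≡ v
      value-injective (inj₁ x) (inj₁ y) eq = cong inj₁ (toℕ-injective
        (square-injective (toℕ x) (toℕ y) (ℕP.≤-pred (toℕ<n x)) (ℕP.≤-pred (toℕ<n y)) eq))
      value-injective (inj₁ x) (inj₂ (inj₁ j)) eq = ⊥-elim (square≢coset (+ toℕ x) j (≋-sym eq))
      value-injective (inj₁ x) (inj₂ (inj₂ _)) eq = ⊥-elim (b-nonsquare (+ toℕ x , eq))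
      value-injective (inj₂ (inj₁ j)) (inj₁ x) eq = ⊥-elim (square≢coset (+ toℕ x) j eq)
      value-injective (inj₂ (inj₁ i)) (inj₂ (inj₁ j)) eq = cong (inj₂ ∘ inj₁) (toℕ-injective
        (ℕP.suc-injective (square-injective (suc (toℕ i)) (suc (toℕ j)) (toℕ<n i) (toℕ<n j)
          (*-cancelˡ a a≋̸0 eq))))
      value-injective (inj₂ (inj₁ j)) (inj₂ (inj₂ _)) eq = ⊥-elim (b∉aQ j eq)
      value-injective (inj₂ (inj₂ _)) (inj₁ x) eq = ⊥-elim (b-nonsquare (+ toℕ x , ≋-sym eq))
      value-injective (inj₂ (inj₂ _)) (inj₂ (inj₁ j)) eq = ⊥-elim (b∉aQ j (≋-sym eq))
      value-injective (inj₂ (inj₂ zero)) (inj₂ (inj₂ zero)) _ = refl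

      split : Fin (suc h ℕ.+ (h ℕ.+ 1)) → Index
      split = Sum.map₂ (splitAt h) ∘ splitAt (suc h)

      unsplit : Index → Fin (suc h ℕ.+ (h ℕ.+ 1))
      unsplit = join (suc h) (h ℕ.+ 1) ∘ Sum.map₂ (join h 1)

      unsplit-split : ∀ i → unsplit (split i) ≡ i
      unsplit-split i with splitAt (suc h) i | join-splitAt (suc h) (h ℕ.+ 1) i
      ... | inj₁ x | eq = eq
      ... | inj₂ y | eq = trans (cong (join (suc h) (h ℕ.+ 1) ∘ inj₂) (join-splitAt h 1 y)) eq

      impossible : ⊥
      impossible with pigeonhole p<size (residue ∘ value ∘ split)
        where
        p<size : p ℕ.< suc h ℕ.+ (h ℕ.+ 1)
        p<size = subst₂ ℕ._<_ (sym p≡1+2h)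
          (cong suc (sym (trans (sym (ℕP.+-assoc h h 1)) (ℕP.+-comm (h ℕ.+ h) 1))))
          (ℕP.n<1+n (suc (h ℕ.+ h)))
      ... | i , j , i<j , eq = <⇒≢ i<j (trans (sym (unsplit-split i)) (trans
        (cong unsplit (value-injective (split i) (split j) (begin
          value (split i)                        ≈⟨ residue-≋ (value (split i)) ⟨
          + toℕ (residue (value (split i)))      ≡⟨ cong (λ r → + toℕ r) eq ⟩
          + toℕ (residue (value (split j)))      ≈⟨ residue-≋ (value (split j)) ⟩
          value (split j)                        ∎)))
        (unsplit-split j)))

  -- Counting classes forces `b` into the coset of `a`, that is b ≡ a y², and then a b ≡ (a y)². No
  -- primitive root and no Euler criterion is involved.
  nonsquare*nonsquare : ∀ {a b} → ¬ Square a → ¬ Square b → Square (a * b)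
  nonsquare*nonsquare {a} {b} a-nonsquare b-nonsquare
    with any? (λ (j : Fin h) → a * (+ suc (toℕ j) * + suc (toℕ j)) ≋? b)
  ... | yes (j , eq) = a * y , (begin
    a * y * (a * y)   ≡⟨ regroup a y ⟩
    a * (a * (y * y)) ≈⟨ *-congˡ a eq ⟩
    a * b             ∎)
    where
    y = + suc (toℕ j)
    regroup : ∀ a y → a * y * (a * y) ≡ a * (a * (y * y))
    regroup = solve-∀
  ... | no b∉aQ = ⊥-elim (CosetCover.impossible
    (λ a≋0 → a-nonsquare (0ℤ , ≋-sym a≋0)) a-nonsquare b-nonsquare (λ j eq → b∉aQ (j , eq)))

  square*nonsquare : ∀ {a b} → ¬ (a ≋ 0ℤ) → Square a → ¬ Square b → ¬ Square (a * b)
  square*nonsquare {a} {b} a≋̸0 (x , xx≋a) b-nonsquare ab-square =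
    b-nonsquare (square-quotient x x≋̸0 (*-congʳ b xx≋a) ab-square)
    where
    x≋̸0 : ¬ (x ≋ 0ℤ)
    x≋̸0 x≋0 = a≋̸0 (≋-trans (≋-sym xx≋a) (*-cong x≋0 x≋0))

  χ-* : ∀ a b → χ (a * b) ≡ χ a * χ b
  χ-* a b with a ≋? 0ℤ | b ≋? 0ℤ
  ... | yes a≋0 | _ = trans (χ-zero (≋-trans (*-congʳ b a≋0) (≋-reflexive (ℤP.*-zeroˡ b))))
    (sym (cong (_* χ b) (χ-zero a≋0)))
  ... | no _ | yes b≋0 = trans (χ-zero (≋-trans (*-congˡ a b≋0) (≋-reflexive (ℤP.*-zeroʳ a))))
    (sym (trans (cong (χ a *_) (χ-zero b≋0)) (ℤP.*-zeroʳ (χ a))))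
  ... | no a≋̸0 | no b≋̸0 with square? a | square? b
  ...   | yes a-sq@(x , xx≋a) | yes b-sq@(y , yy≋b) = trans
    (χ-square (*-≋̸0 a≋̸0 b≋̸0) (x * y , ≋-trans (≋-reflexive (interchange x y)) (*-cong xx≋a yy≋b)))
    (sym (cong₂ _*_ (χ-square a≋̸0 a-sq) (χ-square b≋̸0 b-sq)))
    where
    interchange : ∀ a b → a * b * (a * b) ≡ a * a * (b * b)
    interchange = solve-∀
  ...   | yes a-sq | no b-non = trans (χ-nonsquare (square*nonsquare a≋̸0 a-sq b-non))
    (sym (cong₂ _*_ (χ-square a≋̸0 a-sq) (χ-nonsquare b-non)))
  ...   | no a-non | yes b-sq = trans
    (χ-nonsquare (square*nonsquare b≋̸0 b-sq a-non ∘ square-cong (≋-reflexive (ℤP.*-comm a b))))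
    (sym (cong₂ _*_ (χ-nonsquare a-non) (χ-square b≋̸0 b-sq)))
  ...   | no a-non | no b-non = trans
    (χ-square (*-≋̸0 a≋̸0 b≋̸0) (nonsquare*nonsquare a-non b-non))
    (sym (cong₂ _*_ (χ-nonsquare a-non) (χ-nonsquare b-non)))

  χ*χ : ∀ {a} → ¬ (a ≋ 0ℤ) → χ a * χ a ≡ 1ℤ
  χ*χ {a} a≋̸0 = trans (sym (χ-* a a)) (χ-square (*-≋̸0 a≋̸0 a≋̸0) (a , ≋-refl))

-- Finite products, powers and double factorials

∑-toℕ-last : ∀ n (f : ℕ → ℤ) → ∑ {suc n} (λ i → f (toℕ i)) ≡ ∑ {n} (λ i → f (toℕ i)) + f n
∑-toℕ-last n f = trans (ΣP.sum-init-last {n} (λ i → f (toℕ i)))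
  (cong₂ _+_ (∑-cong {n} λ i → cong f (toℕ-inject₁ i)) (cong f (toℕ-fromℕ n)))

∏< : ℕ → (ℕ → ℤ) → ℤ
∏< n f = ∏ {n} λ i → f (toℕ i)

∏<-last : ∀ n f → ∏< (suc n) f ≡ ∏< n f * f n
∏<-last n f = trans (ΠP.sum-init-last {n} (λ i → f (toℕ i)))
  (cong₂ _*_ (ΠP.sum-cong-≗ {n} λ i → cong f (toℕ-inject₁ i)) (cong f (toℕ-fromℕ n)))

∏<-cong : ∀ n {f g} → (∀ i → i ℕ.< n → f i ≡ g i) → ∏< n f ≡ ∏< n g
∏<-cong n f≡g = ΠP.sum-cong-≗ {n} λ i → f≡g (toℕ i) (toℕ<n i)

∏<-* : ∀ n f g → ∏< n (λ i → f i * g i) ≡ ∏< n f * ∏< n g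
∏<-* n f g = ΠP.∑-distrib-+ {n} (λ i → f (toℕ i)) (λ i → g (toℕ i))

∏<-const : ∀ n a → ∏< n (λ _ → a) ≡ a ^ n
∏<-const zero    a = refl
∏<-const (suc n) a = cong (a *_) (∏<-const n a)

-- Pairs opposite indices. Read forwards it makes the product of the symmetric binomials a square;
-- read backwards it merges the factorials of r and m + 1 - r into a single product.
∏<-fold : ∀ g f → ∏< (g ℕ.+ g) f ≡ ∏< g (λ i → f i * f (g ℕ.+ g ℕ.∸ suc i))
∏<-fold zero    f = refl
∏<-fold (suc g) f = begin
  f 0 * ∏< (g ℕ.+ suc g) (f ∘ suc)
    ≡⟨ cong (λ n → f 0 * ∏< n (f ∘ suc)) (ℕP.+-suc g g) ⟩
  f 0 * ∏< (suc (g ℕ.+ g)) (f ∘ suc)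
    ≡⟨ cong (f 0 *_) (∏<-last (g ℕ.+ g) (f ∘ suc)) ⟩
  f 0 * (∏< (g ℕ.+ g) (f ∘ suc) * f (suc (g ℕ.+ g)))
    ≡⟨ cong₂ (λ u v → f 0 * (u * f v)) (∏<-fold g (f ∘ suc)) (sym (ℕP.+-suc g g)) ⟩
  f 0 * (∏< g (λ i → f (suc i) * f (suc (g ℕ.+ g ℕ.∸ suc i))) * f (g ℕ.+ suc g))
    ≡⟨ cong (λ z → f 0 * (z * f (g ℕ.+ suc g))) (∏<-cong g λ i i<g → cong (λ k → f (suc i) * f k) (index i i<g)) ⟩
  f 0 * (∏< g (λ i → f (suc i) * f (g ℕ.+ suc g ℕ.∸ suc i)) * f (g ℕ.+ suc g))
    ≡⟨ swap (f 0) (∏< g (λ i → f (suc i) * f (g ℕ.+ suc g ℕ.∸ suc i))) (f (g ℕ.+ suc g)) ⟩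
  f 0 * f (g ℕ.+ suc g) * ∏< g (λ i → f (suc i) * f (g ℕ.+ suc g ℕ.∸ suc i)) ∎
  where
  open ≡-Reasoning
  swap : ∀ a b c → a * (b * c) ≡ a * c * b
  swap = solve-∀
  index : ∀ i → i ℕ.< g → suc (g ℕ.+ g ℕ.∸ suc i) ≡ g ℕ.+ suc g ℕ.∸ suc i
  index i i<g = trans (sym (ℕP.+-∸-assoc 1 (ℕP.≤-trans i<g (ℕP.m≤m+n g g))))
    (cong (ℕ._∸ suc i) (sym (ℕP.+-suc g g)))

nC0≡1 : ∀ n → n C 0 ≡ 1
nC0≡1 n = trans (nCk≡nC[n∸k] {0} {n} z≤n) (nCn≡1 n)

-- The left side is what `3 + n ∸ (2 + i)` computes to; on the right, `n ∸ suc i` is the index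
-- opposite to `i`.
complement : ∀ {n i} → i ℕ.< n → suc n ℕ.∸ i ≡ 2 ℕ.+ (n ℕ.∸ suc i)
complement i<n = ℕP.+-∸-assoc 2 i<n

*-^ : ∀ x y n → (x * y) ^ n ≡ x ^ n * y ^ n
*-^ x y zero    = refl
*-^ x y (suc n) = trans (cong (x * y *_) (*-^ x y n)) (interchange x y (x ^ n) (y ^ n))
  where
  interchange : ∀ a b c d → a * b * (c * d) ≡ a * c * (b * d)
  interchange = solve-∀

^-double : ∀ x n → x ^ (n ℕ.+ n) ≡ x ^ n * x ^ n
^-double x n = ℤP.^-distribˡ-+-* x n n

n!≡n!!*[n-1]!! : ∀ n → suc n ! ≡ suc n !! ℕ.* n !!
n!≡n!!*[n-1]!! zero    = refl
n!≡n!!*[n-1]!! (suc n) = begin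
  suc (suc n) ℕ.* suc n !                ≡⟨ cong (suc (suc n) ℕ.*_) (n!≡n!!*[n-1]!! n) ⟩
  suc (suc n) ℕ.* (suc n !! ℕ.* n !!)    ≡⟨ cong (suc (suc n) ℕ.*_) (ℕP.*-comm (suc n !!) (n !!)) ⟩
  suc (suc n) ℕ.* (n !! ℕ.* suc n !!)    ≡⟨ ℕP.*-assoc (suc (suc n)) (n !!) (suc n !!) ⟨
  suc (suc n) !! ℕ.* suc n !!            ∎
  where open ≡-Reasoning

-- The determinant modulo p

module PowerOfDifference (p n : ℕ) (n-even : -1ℤ ^ n ≡ 1ℤ) where
  open Modular p
  open ≋-Reasoning

  -- With m = n + 2 these are binom(m + 1, r) for r = 2, ..., m - 1, shifted to start at i = 0.
  coefficient : ℕ → ℤ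
  coefficient i = + ((3 ℕ.+ n) C (2 ℕ.+ i))

  coefficients : Matrix (2 ℕ.+ n)
  coefficients = skewCoefficients (+ (4 ℕ.+ n)) (λ i → coefficient (toℕ i))

  -- Modulo x^(n+2) = y^(n+2) = 1, the two outer terms on either side of the binomial
  -- expansion combine to (n + 4) (x - y).
  difference-power : ∀ x y → x ^ (2 ℕ.+ n) ≋ 1ℤ → y ^ (2 ℕ.+ n) ≋ 1ℤ →
    (x + -1ℤ * y) ^ (3 ℕ.+ n) ≋
    ∑ λ r → x ^ toℕ r * ∑ λ t → coefficients r t * y ^ toℕ t
  difference-power x y xᵐ≋1 yᵐ≋1 = begin
    (x + z) ^ (3 ℕ.+ n)
      ≡⟨ binomial-theorem (3 ℕ.+ n) x z ⟩
    term 0 + (term 1 + ∑ {2 ℕ.+ n} (λ i → term (2 ℕ.+ toℕ i)))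
      ≡⟨ cong (λ w → term 0 + (term 1 + w)) (trans
           (∑-toℕ-last (suc n) (λ i → term (2 ℕ.+ i)))
           (cong (λ w → w + term (3 ℕ.+ n)) (∑-toℕ-last n (λ i → term (2 ℕ.+ i))))) ⟩
    term 0 + (term 1 + (∑ {n} (λ i → term (2 ℕ.+ toℕ i)) + term (2 ℕ.+ n) + term (3 ℕ.+ n)))
      ≈⟨ +-cong term₀ (+-cong term₁ (+-cong (+-cong
           (≋-reflexive (∑-cong {n} λ i → middle i)) term₋₁) term₋₀)) ⟩
    -1ℤ * y + (c * x + (∑ rest + c * (-1ℤ * y) + x))
      -- `1ℤ + c` is m + 2. The factors `1ℤ` are those inside the powers with exponents 0 and 1, so
      -- that the result matches `skewCoefficients-form` by computation.
      ≡⟨ collect c x y (∑ rest) ⟩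
    (1ℤ + c) * (x * 1ℤ * 1ℤ - 1ℤ * (y * 1ℤ)) + ∑ rest
      ≡⟨ skewCoefficients-form {n} (+ (4 ℕ.+ n)) (λ i → coefficient (toℕ i))
           (λ r → x ^ toℕ r) (λ t → y ^ toℕ t) ⟨
    ∑ (λ r → x ^ toℕ r * ∑ λ t → coefficients r t * y ^ toℕ t) ∎
    where
    z = -1ℤ * y
    c = + (3 ℕ.+ n)
    term : ℕ → ℤ
    term r = + ((3 ℕ.+ n) C r) * (x ^ r * z ^ (3 ℕ.+ n ℕ.∸ r))
    rest : Fin n → ℤ
    rest i = x ^ (2 ℕ.+ toℕ i) *
      (-1ℤ ^ toℕ (opposite i) * coefficient (toℕ i) * y ^ (2 ℕ.+ toℕ (opposite i)))
    collect : ∀ c x y r → -1ℤ * y + (c * x + (r + c * (-1ℤ * y) + x)) ≡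
                          (1ℤ + c) * (x * 1ℤ * 1ℤ - 1ℤ * (y * 1ℤ)) + r
    collect = solve-∀
    zᵐ≋1 : z ^ (2 ℕ.+ n) ≋ 1ℤ
    zᵐ≋1 = begin
      z ^ (2 ℕ.+ n)                    ≡⟨ *-^ -1ℤ y (2 ℕ.+ n) ⟩
      -1ℤ ^ (2 ℕ.+ n) * y ^ (2 ℕ.+ n)  ≈⟨ *-congˡ (-1ℤ ^ (2 ℕ.+ n)) yᵐ≋1 ⟩
      -1ℤ ^ (2 ℕ.+ n) * 1ℤ             ≡⟨ cong (λ w → -1ℤ * (-1ℤ * w) * 1ℤ) n-even ⟩
      1ℤ                               ∎
    term₀ : term 0 ≋ -1ℤ * y
    term₀ = begin
      term 0                           ≡⟨ cong (λ k → + k * (1ℤ * (z * z ^ (2 ℕ.+ n)))) (nC0≡1 (3 ℕ.+ n)) ⟩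
      1ℤ * (1ℤ * (z * z ^ (2 ℕ.+ n)))  ≈⟨ *-congˡ 1ℤ (*-congˡ 1ℤ (*-congˡ z zᵐ≋1)) ⟩
      1ℤ * (1ℤ * (z * 1ℤ))             ≡⟨ simp z ⟩
      z                                ∎
      where
      simp : ∀ z → 1ℤ * (1ℤ * (z * 1ℤ)) ≡ z
      simp = solve-∀
    term₁ : term 1 ≋ c * x
    term₁ = begin
      term 1                              ≡⟨ cong (λ k → + k * (x * 1ℤ * z ^ (2 ℕ.+ n))) (nC1≡n (3 ℕ.+ n)) ⟩
      c * (x * 1ℤ * z ^ (2 ℕ.+ n))        ≈⟨ *-congˡ c (*-congˡ (x * 1ℤ) zᵐ≋1) ⟩
      c * (x * 1ℤ * 1ℤ)                   ≡⟨ simp c x ⟩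
      c * x                               ∎
      where
      simp : ∀ c x → c * (x * 1ℤ * 1ℤ) ≡ c * x
      simp = solve-∀
    term₋₁ : term (2 ℕ.+ n) ≋ c * (-1ℤ * y)
    term₋₁ = begin
      term (2 ℕ.+ n)
        ≡⟨ cong₂ (λ k l → + k * (x ^ (2 ℕ.+ n) * z ^ l)) binomial (ℕP.m+n∸n≡m 1 n) ⟩
      c * (x ^ (2 ℕ.+ n) * z ^ 1)  ≈⟨ *-congˡ c (*-congʳ (z ^ 1) xᵐ≋1) ⟩
      c * (1ℤ * (z * 1ℤ))          ≡⟨ simp c z ⟩
      c * z                        ∎
      where
      binomial : (3 ℕ.+ n) C (2 ℕ.+ n) ≡ 3 ℕ.+ n
      binomial = trans (nCk≡nC[n∸k] {2 ℕ.+ n} {3 ℕ.+ n} (ℕP.n≤1+n (2 ℕ.+ n)))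
        (trans (cong ((3 ℕ.+ n) C_) (ℕP.m+n∸n≡m 1 n)) (nC1≡n (3 ℕ.+ n)))
      simp : ∀ c z → c * (1ℤ * (z * 1ℤ)) ≡ c * z
      simp = solve-∀
    term₋₀ : term (3 ℕ.+ n) ≋ x
    term₋₀ = begin
      term (3 ℕ.+ n)
        ≡⟨ cong₂ (λ k l → + k * (x * x ^ (2 ℕ.+ n) * z ^ l)) (nCn≡1 (3 ℕ.+ n)) (ℕP.n∸n≡0 n) ⟩
      1ℤ * (x * x ^ (2 ℕ.+ n) * 1ℤ)  ≈⟨ *-congˡ 1ℤ (*-congʳ 1ℤ (*-congˡ x xᵐ≋1)) ⟩
      1ℤ * (x * 1ℤ * 1ℤ)             ≡⟨ simp x ⟩
      x                              ∎
      where
      simp : ∀ x → 1ℤ * (x * 1ℤ * 1ℤ) ≡ x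
      simp = solve-∀
    middle : ∀ i → term (2 ℕ.+ toℕ i) ≡ rest i
    middle i = trans
      (cong (λ l → coefficient (toℕ i) * (x ^ (2 ℕ.+ toℕ i) * l)) (trans
        (cong (z ^_) (trans (complement (toℕ<n i)) (cong (2 ℕ.+_) (sym (opposite-prop i)))))
        (*-^ -1ℤ y (2 ℕ.+ toℕ (opposite i)))))
      (regroup (coefficient (toℕ i)) (x ^ (2 ℕ.+ toℕ i)) (-1ℤ ^ toℕ (opposite i)) (y ^ (2 ℕ.+ toℕ (opposite i))))
      where
      regroup : ∀ c x s y → c * (x * (-1ℤ * (-1ℤ * s) * y)) ≡ x * (s * c * y)
      regroup = solve-∀

  det-difference-powers : (α : Fin (2 ℕ.+ n) → ℤ) → (∀ i → α i ^ (2 ℕ.+ n) ≋ 1ℤ) →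
    S (3 ℕ.+ n) -1ℤ α ≋
    T α * T α * (+ (4 ℕ.+ n) * + (4 ℕ.+ n) * ∏< n coefficient)
  det-difference-powers α αᵐ≋1 = begin
    S (3 ℕ.+ n) -1ℤ α
      ≈⟨ det-≋ (λ i j → difference-power (α i) (α j) (αᵐ≋1 i) (αᵐ≋1 j)) ⟩
    det (powers α · (coefficients · flip (powers α)))
      ≡⟨ det-· (powers α) (coefficients · flip (powers α)) ⟩
    det (powers α) * det (coefficients · flip (powers α))
      ≡⟨ cong₂ _*_ (det-powers α) (trans (det-· coefficients (flip (powers α)))
           (cong₂ _*_ (det-skewCoefficients {n} (+ (4 ℕ.+ n)) λ i → coefficient (toℕ i)) (det-powersᵀ α))) ⟩
    v * (d * v)
      ≡⟨ regroup v d ⟩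
    v * v * d
      ≡⟨ cong (_* d) (vandermonde² α) ⟩
    T α * T α * d ∎
    where
    v = vandermonde α
    d = + (4 ℕ.+ n) * + (4 ℕ.+ n) * ∏< n coefficient
    regroup : ∀ v d → v * (d * v) ≡ v * v * d
    regroup = solve-∀

-- Legendre symbols of binomials and factorials

module LegendreFactorials (p : ℕ) (p-prime : Prime p) (h : ℕ) (p≡1+2h : p ≡ suc (h ℕ.+ h)) where
  open LegendreSymbol p p-prime h p≡1+2h public
  open ≡-Reasoning

  χ-1 : χ 1ℤ ≡ 1ℤ
  χ-1 = χ-square 1≋̸0 (1ℤ , ≋-refl)

  χ-ℕ* : ∀ a b → χ (+ (a ℕ.* b)) ≡ χ (+ a) * χ (+ b)
  χ-ℕ* a b = trans (cong χ (ℤP.pos-* a b)) (χ-* (+ a) (+ b))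

  χ-∏< : ∀ n f → χ (∏< n f) ≡ ∏< n (χ ∘ f)
  χ-∏< zero    f = χ-1
  χ-∏< (suc n) f = trans (χ-* (f 0) (∏< n (f ∘ suc))) (cong (χ (f 0) *_) (χ-∏< n (f ∘ suc)))

  -- Below `p` factorials are units, so their symbols are their own inverses and the denominator may
  -- be moved to the numerator.
  χ-binomial : ∀ {n r} → r ℕ.≤ n → n ℕ.< p →
    χ (+ (n C r)) ≡ χ (+ (n !)) * (χ (+ (r !)) * χ (+ ((n ℕ.∸ r) !)))
  χ-binomial {n} {r} r≤n n<p = sym (begin
    χ (+ (n !)) * (a * b)
      ≡⟨ cong (λ z → χ (+ z) * (a * b)) (nCk*k![n∸k]!≡n! r≤n) ⟨
    χ (+ ((n C r) ℕ.* (r ! ℕ.* (n ℕ.∸ r) !))) * (a * b)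
      ≡⟨ cong (_* (a * b)) (trans (χ-ℕ* (n C r) (r ! ℕ.* (n ℕ.∸ r) !))
           (cong (χ (+ (n C r)) *_) (χ-ℕ* (r !) ((n ℕ.∸ r) !)))) ⟩
    χ (+ (n C r)) * (a * b) * (a * b)
      ≡⟨ regroup (χ (+ (n C r))) a b ⟩
    χ (+ (n C r)) * (a * a) * (b * b)
      ≡⟨ cong₂ (λ u v → χ (+ (n C r)) * u * v) (χ*χ (!-≋̸0 (ℕP.≤-<-trans r≤n n<p)))
           (χ*χ (!-≋̸0 (ℕP.≤-<-trans (ℕP.m∸n≤m n r) n<p))) ⟩
    χ (+ (n C r)) * 1ℤ * 1ℤ
      ≡⟨ simp (χ (+ (n C r))) ⟩
    χ (+ (n C r)) ∎)
    where
    a = χ (+ (r !))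
    b = χ (+ ((n ℕ.∸ r) !))
    regroup : ∀ c a b → c * (a * b) * (a * b) ≡ c * (a * a) * (b * b)
    regroup = solve-∀
    simp : ∀ c → c * 1ℤ * 1ℤ ≡ c
    simp = solve-∀

  -- (2j)! (2j+1)! is the square of (2j)! times 2j + 1.
  χ-∏! : ∀ g → 1 ℕ.+ (g ℕ.+ g) ℕ.< p →
    ∏< (g ℕ.+ g) (λ i → χ (+ ((2 ℕ.+ i) !))) ≡ χ (+ ((1 ℕ.+ (g ℕ.+ g)) !!))
  χ-∏! zero    _ = sym χ-1
  χ-∏! (suc g) bound rewrite ℕP.+-suc g g = begin
    ∏< (2 ℕ.+ n) G
      ≡⟨ trans (∏<-last (suc n) G) (cong (_* G (suc n)) (∏<-last n G)) ⟩
    ∏< n G * G n * G (suc n)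
      ≡⟨ cong₂ (λ u v → u * G n * v) (χ-∏! g (ℕP.≤-trans (s≤s (ℕP.≤-trans (ℕP.n≤1+n _) (ℕP.n≤1+n _))) bound))
           (χ-ℕ* (3 ℕ.+ n) ((2 ℕ.+ n) !)) ⟩
    χ (+ ((1 ℕ.+ n) !!)) * G n * (χ (+ (3 ℕ.+ n)) * G n)
      ≡⟨ regroup (χ (+ ((1 ℕ.+ n) !!))) (G n) (χ (+ (3 ℕ.+ n))) ⟩
    χ (+ (3 ℕ.+ n)) * χ (+ ((1 ℕ.+ n) !!)) * (G n * G n)
      ≡⟨ cong (χ (+ (3 ℕ.+ n)) * χ (+ ((1 ℕ.+ n) !!)) *_) (χ*χ (!-≋̸0 (ℕP.<-trans (ℕP.n<1+n _) bound))) ⟩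
    χ (+ (3 ℕ.+ n)) * χ (+ ((1 ℕ.+ n) !!)) * 1ℤ
      ≡⟨ ℤP.*-identityʳ (χ (+ (3 ℕ.+ n)) * χ (+ ((1 ℕ.+ n) !!))) ⟩
    χ (+ (3 ℕ.+ n)) * χ (+ ((1 ℕ.+ n) !!))
      ≡⟨ χ-ℕ* (3 ℕ.+ n) ((1 ℕ.+ n) !!) ⟨
    χ (+ ((3 ℕ.+ n) !!)) ∎
    where
    n = g ℕ.+ g
    G : ℕ → ℤ
    G i = χ (+ ((2 ℕ.+ i) !))
    regroup : ∀ a b c → a * b * (c * b) ≡ c * a * (b * b)
    regroup = solve-∀

-- The square root of the determinant and its symbol

module SquareRoot (p : ℕ) (p-prime : Prime p) (k g : ℕ) (2≤k : 2 ℕ.≤ k)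
  (p≡ : p ≡ suc (k ℕ.* suc g ℕ.+ k ℕ.* suc g)) where

  -- `g` is m/2 - 1, so m = 2 + n with `n` even; `h` is (p - 1)/2 = k m/2.
  h n : ℕ
  h = k ℕ.* suc g
  n = g ℕ.+ g

  open LegendreFactorials p p-prime h p≡ public
  open PowerOfDifference p n (trans (^-double -1ℤ g) (-1^n*-1^n g)) public

  pred-p : ℕ.pred p ≡ k ℕ.* (2 ℕ.+ n)
  pred-p = trans (cong ℕ.pred p≡) (trans (sym (ℕP.*-distribˡ-+ k (suc g) (suc g)))
    (cong (λ z → k ℕ.* suc z) (ℕP.+-suc g g)))

  -- This is where k ≥ 2 enters: m + 2 ≤ 2m ≤ k m = p - 1. It makes (m + 1)! a unit modulo `p`.
  4+n<p : 4 ℕ.+ n ℕ.< p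
  4+n<p = subst (4 ℕ.+ n ℕ.<_) (trans (cong suc (sym pred-p)) (ℕP.suc-pred p)) (s≤s (begin
    4 ℕ.+ n                ≤⟨ ℕP.+-monoʳ-≤ 4 (ℕP.m≤m+n n n) ⟩
    4 ℕ.+ (n ℕ.+ n)        ≡⟨ double n ⟩
    2 ℕ.* (2 ℕ.+ n)        ≤⟨ ℕP.*-monoˡ-≤ (2 ℕ.+ n) 2≤k ⟩
    k ℕ.* (2 ℕ.+ n)        ∎))
    where
    open ℕP.≤-Reasoning
    double : ∀ n → 4 ℕ.+ (n ℕ.+ n) ≡ 2 ℕ.* (2 ℕ.+ n)
    double = ℕSolver.solve-∀

  3+n<p : 3 ℕ.+ n ℕ.< p
  3+n<p = ℕP.<-trans (ℕP.n<1+n _) 4+n<p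

  k≋̸0 : ¬ (+ k ≋ 0ℤ)
  k≋̸0 = 0<a<n⇒≋̸0 (ℕP.≤-trans (s≤s z≤n) 2≤k) (subst (k ℕ.<_)
    (trans (cong suc (sym pred-p)) (ℕP.suc-pred p)) (s≤s (ℕP.m≤m*n k (2 ℕ.+ n))))

  pfaffian : ℤ
  pfaffian = + (4 ℕ.+ n) * ∏< g coefficient

  ∏-coefficient : ∏< n coefficient ≡ ∏< g coefficient * ∏< g coefficient
  ∏-coefficient = trans (∏<-fold g coefficient) (trans
    (∏<-cong g λ i i<g → cong (coefficient i *_) (symmetric i (ℕP.≤-trans i<g (ℕP.m≤m+n g g))))
    (∏<-* g coefficient coefficient))
    where
    symmetric : ∀ i → i ℕ.< n → coefficient (n ℕ.∸ suc i) ≡ coefficient i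
    symmetric i i<n = cong +_ (sym (trans
      (nCk≡nC[n∸k] {2 ℕ.+ i} {3 ℕ.+ n} (s≤s (s≤s (ℕP.≤-trans (ℕP.<⇒≤ i<n) (ℕP.n≤1+n n)))))
      (cong ((3 ℕ.+ n) C_) (complement i<n))))

  -- Each of the `g` binomials contributes (m + 1)! and a pair r!, (m + 1 - r)!. The pairs exhaust
  -- 2!, ..., (m - 1)!, whose product has the symbol of (m - 1)!!.
  χ-pfaffian : χ pfaffian ≡ χ (+ (4 ℕ.+ n)) * (χ (+ ((3 ℕ.+ n) !)) ^ g * χ (+ ((1 ℕ.+ n) !!)))
  χ-pfaffian = trans (χ-* (+ (4 ℕ.+ n)) (∏< g coefficient)) (cong (χ (+ (4 ℕ.+ n)) *_) (begin
    χ (∏< g coefficient)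
      ≡⟨ χ-∏< g coefficient ⟩
    ∏< g (χ ∘ coefficient)
      ≡⟨ ∏<-cong g (λ i i<g → factor i (ℕP.≤-trans i<g (ℕP.m≤m+n g g))) ⟩
    ∏< g (λ i → A * (G i * G (n ℕ.∸ suc i)))
      ≡⟨ ∏<-* g (λ _ → A) (λ i → G i * G (n ℕ.∸ suc i)) ⟩
    ∏< g (λ _ → A) * ∏< g (λ i → G i * G (n ℕ.∸ suc i))
      ≡⟨ cong₂ _*_ (∏<-const g A) (trans (sym (∏<-fold g G))
           (χ-∏! g (ℕP.<-trans (ℕP.n<1+n _) (ℕP.<-trans (ℕP.n<1+n _) 3+n<p)))) ⟩
    A ^ g * χ (+ ((1 ℕ.+ n) !!)) ∎))
    where
    open ≡-Reasoning
    A = χ (+ ((3 ℕ.+ n) !))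
    G : ℕ → ℤ
    G i = χ (+ ((2 ℕ.+ i) !))
    factor : ∀ i → i ℕ.< n → χ (coefficient i) ≡ A * (G i * G (n ℕ.∸ suc i))
    factor i i<n = trans
      (χ-binomial {3 ℕ.+ n} {2 ℕ.+ i} (s≤s (s≤s (ℕP.≤-trans (ℕP.<⇒≤ i<n) (ℕP.n≤1+n n)))) 3+n<p)
      (cong (λ r → A * (G i * χ (+ (r !)))) (complement i<n))

  module _ (α : Fin (2 ℕ.+ n) → ℤ) (representation : RepresentsPowerResidues k p α) where
    open RepresentsPowerResidues representation using (distinct) renaming (residue to α-residue)

    private
      root : Fin (2 ℕ.+ n) → ℤ
      root i = proj₁ (proj₂ (α-residue i))

      root^k : ∀ i → root i ^ k ≋ α i
      root^k i = mod (proj₂ (proj₂ (α-residue i)))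

      root≋̸0 : ∀ i → ¬ (root i ≋ 0ℤ)
      root≋̸0 i x≋0 = proj₁ (α-residue i) (unmod (≋-trans (≋-sym (root^k i)) (zero-power k 2≤k)))
        where
        zero-power : ∀ k → 2 ℕ.≤ k → root i ^ k ≋ 0ℤ
        zero-power (suc k) _ = ≋-trans (*-congʳ (root i ^ k) x≋0) (≋-reflexive (ℤP.*-zeroˡ (root i ^ k)))

      α-power : ∀ i e → α i ^ e ≋ root i ^ (k ℕ.* e)
      α-power i e = ≋-trans (^-cong e (≋-sym (root^k i))) (≋-reflexive (ℤP.^-*-assoc (root i) k e))

      αᵐ≋1 : ∀ i → α i ^ (2 ℕ.+ n) ≋ 1ℤ
      αᵐ≋1 i = ≋-trans (α-power i (2 ℕ.+ n))
        (≋-trans (≋-reflexive (cong (root i ^_) (sym pred-p))) (fermat-unit (root≋̸0 i)))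

      T≋̸0 : ¬ (T α ≋ 0ℤ)
      T≋̸0 = ∏-≋̸0 {2 ℕ.+ n} λ i → ∏-≋̸0 {2 ℕ.+ n} λ j → factor i j
        where
        factor : ∀ i j → ¬ ((if does (i <? j) then α i - α j else 1ℤ) ≋ 0ℤ)
        factor i j = branch (i <? j) λ i<j d → <⇒≢ i<j (distinct i j (unmod (difference⇒≋ {α i} {α j} d)))
          where
          branch : ∀ {P : Set} {a} (P? : Dec P) → (P → ¬ (a ≋ 0ℤ)) →
                   ¬ ((if does P? then a else 1ℤ) ≋ 0ℤ)
          branch (yes q) a≋̸0 = a≋̸0 q
          branch (no _)  _   = 1≋̸0

      -- Otherwise rows 0 and m/2 of the Vandermonde matrix coincide.
      half-power-not-all-one : ¬ (∀ i → α i ^ suc g ≋ 1ℤ)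
      half-power-not-all-one all-one = [ T≋̸0 , T≋̸0 ]′ (euclid (T α) (T α) T²≋0)
        where
        open ≋-Reasoning
        half : Fin (2 ℕ.+ n)
        half = suc (fromℕ< (s≤s (ℕP.m≤m+n g g)))
        toℕ-half : toℕ half ≡ suc g
        toℕ-half = cong suc (toℕ-fromℕ< (s≤s (ℕP.m≤m+n g g)))
        -- Alternation is a statement about equal integers, so the row that is only congruent to 1
        -- is replaced by an actual row of ones.
        B : Matrix (2 ℕ.+ n)
        B = updateAt (flip (powers α)) half λ _ _ → 1ℤ
        V≋B : ∀ r j → α j ^ toℕ r ≋ B r j
        V≋B r j with r ≟ half
        ... | no r≢half = ≋-reflexive (sym (cong-app (updateAt-minimal r half (flip (powers α)) r≢half) j))
        ... | yes refl  = ≋-trans (≋-reflexive (cong (α j ^_) toℕ-half)) (≋-trans (all-one j)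
          (≋-reflexive (sym (cong-app (updateAt-updates half (flip (powers α))) j))))
        B-half : ∀ j → B zero j ≡ B half j
        B-half j = sym (cong-app (updateAt-updates half (flip (powers α))) j)
        v≋0 : vandermonde α ≋ 0ℤ
        v≋0 = begin
          vandermonde α            ≡⟨ det-powersᵀ α ⟨
          det (flip (powers α))    ≈⟨ det-≋ V≋B ⟩
          det B                    ≡⟨ Alternating.alternating (det-alternating (2 ℕ.+ n)) {B} zero half (λ ()) B-half ⟩
          0ℤ                       ∎
        T²≋0 : T α * T α ≋ 0ℤ
        T²≋0 = begin
          T α * T α                      ≡⟨ vandermonde² α ⟨
          vandermonde α * vandermonde α  ≈⟨ *-cong v≋0 v≋0 ⟩
          0ℤ                             ∎

    -- α^(m/2) squares to 1 and so is ±1; an α with value -1 is x^k for some x, whence -1 ≡ x^h, and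
    -- x^h is a square because `h` is even.
    χ[-1]≡1 : ∀ q → h ≡ q ℕ.+ q → χ -1ℤ ≡ 1ℤ
    χ[-1]≡1 q h≡2q = χ-square (λ -1≋0 → 1≋̸0 (*-cong -1≋0 -1≋0)) (root i ^ q , (begin
      root i ^ q * root i ^ q  ≡⟨ ^-double (root i) q ⟨
      root i ^ (q ℕ.+ q)       ≡⟨ cong (root i ^_) h≡2q ⟨
      root i ^ h               ≈⟨ α-power i (suc g) ⟨
      α i ^ suc g              ≈⟨ ≋-1 ⟩
      -1ℤ                      ∎))
      where
      open ≋-Reasoning
      non-one : ∃ λ i → ¬ (α i ^ suc g ≋ 1ℤ)
      non-one = ¬∀⟶∃¬ _ (λ i → α i ^ suc g ≋ 1ℤ) (λ i → (α i ^ suc g) ≋? 1ℤ) half-power-not-all-one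
      i = proj₁ non-one
      αⁱ≋̸1 = proj₂ non-one
      ≋-1 : α i ^ suc g ≋ -1ℤ
      ≋-1 = [ ⊥-elim ∘ αⁱ≋̸1 , (λ e → e) ]′ (square-≋⇒± (α i ^ suc g) 1ℤ (begin
        α i ^ suc g * α i ^ suc g  ≡⟨ ^-double (α i) (suc g) ⟨
        α i ^ (suc g ℕ.+ suc g)    ≡⟨ cong (λ e → α i ^ suc e) (ℕP.+-suc g g) ⟩
        α i ^ (2 ℕ.+ n)            ≈⟨ αᵐ≋1 i ⟩
        1ℤ                         ∎))

    χ-sqrt : ∀ q → h ≡ q ℕ.+ q → ∀ s → IsSqrt s (S (3 ℕ.+ n) -1ℤ α) → χ s ≡ χ pfaffian * χ (T α)
    χ-sqrt q h≡2q s s²≡S = trans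
      ([ χ-cong , (λ e → trans (χ-cong e) (negated (pfaffian * T α))) ]′
        (square-≋⇒± s (pfaffian * T α) (begin
          s * s
            ≡⟨ cong (s *_) (ℤP.*-identityʳ s) ⟨
          s ^ 2
            ≡⟨ s²≡S ⟩
          S (3 ℕ.+ n) -1ℤ α
            ≈⟨ det-difference-powers α αᵐ≋1 ⟩
          T α * T α * (+ (4 ℕ.+ n) * + (4 ℕ.+ n) * ∏< n coefficient)
            ≡⟨ cong (λ z → T α * T α * (+ (4 ℕ.+ n) * + (4 ℕ.+ n) * z)) ∏-coefficient ⟩
          T α * T α * (+ (4 ℕ.+ n) * + (4 ℕ.+ n) * (∏< g coefficient * ∏< g coefficient))
            ≡⟨ regroup (T α) (+ (4 ℕ.+ n)) (∏< g coefficient) ⟩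
          pfaffian * T α * (pfaffian * T α) ∎)))
      (χ-* pfaffian (T α))
      where
      open ≋-Reasoning
      regroup : ∀ t a c → t * t * (a * a * (c * c)) ≡ a * c * t * (a * c * t)
      regroup = solve-∀
      negate : ∀ x → - x ≡ -1ℤ * x
      negate = solve-∀
      negated : ∀ x → χ (- x) ≡ χ x
      negated x = trans (cong χ (negate x)) (trans (χ-* -1ℤ x)
        (trans (cong (_* χ x) (χ[-1]≡1 q h≡2q)) (ℤP.*-identityˡ (χ x))))

  k[2+n]≋-1 : + k * + (2 ℕ.+ n) ≋ -1ℤ
  k[2+n]≋-1 = begin
    + k * + (2 ℕ.+ n)        ≡⟨ ℤP.pos-* k (2 ℕ.+ n) ⟨
    + (k ℕ.* (2 ℕ.+ n))      ≡⟨ cong +_ pred-p ⟨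
    + ℕ.pred p               ≡⟨ shift (+ ℕ.pred p) ⟩
    (1ℤ + + ℕ.pred p) - 1ℤ   ≡⟨ cong (λ z → + z - 1ℤ) (ℕP.suc-pred p) ⟩
    + p - 1ℤ                 ≈⟨ +-cong n≋0 (≋-refl { - 1ℤ}) ⟩
    -1ℤ                      ∎
    where
    open ≋-Reasoning
    shift : ∀ x → x ≡ (1ℤ + x) - 1ℤ
    shift = solve-∀

  k[4+n]≋2k-1 : + k * + (4 ℕ.+ n) ≋ + 2 * + k - 1ℤ
  k[4+n]≋2k-1 = begin
    + k * (+ 2 + + (2 ℕ.+ n))        ≡⟨ expand (+ k) (+ (2 ℕ.+ n)) ⟩
    + 2 * + k + + k * + (2 ℕ.+ n)    ≈⟨ +-cong (≋-refl {+ 2 * + k}) k[2+n]≋-1 ⟩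
    + 2 * + k - 1ℤ                   ∎
    where
    open ≋-Reasoning
    expand : ∀ k m → k * (+ 2 + m) ≡ + 2 * k + k * m
    expand = solve-∀

  k[3+n]≋k-1 : + k * + (3 ℕ.+ n) ≋ + k - 1ℤ
  k[3+n]≋k-1 = begin
    + k * (1ℤ + + (2 ℕ.+ n))         ≡⟨ expand (+ k) (+ (2 ℕ.+ n)) ⟩
    + k + + k * + (2 ℕ.+ n)          ≈⟨ +-cong (≋-refl {+ k}) k[2+n]≋-1 ⟩
    + k - 1ℤ                         ∎
    where
    open ≋-Reasoning
    expand : ∀ k m → k * (1ℤ + m) ≡ k + k * m
    expand = solve-∀

  -- Scaling both factors by `k` changes the product by a square. This exchanges (m + 1)(m + 2) for
  -- (k - 1)(2k - 1).
  χ-k* : ∀ a b → χ (+ k * a * (+ k * b)) ≡ χ a * χ b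
  χ-k* a b = trans (cong χ (interchange (+ k) a b)) (trans (χ-* (+ k * + k) (a * b)) (trans
    (cong₂ _*_ (trans (χ-* (+ k) (+ k)) (χ*χ k≋̸0)) (χ-* a b)) (ℤP.*-identityˡ (χ a * χ b))))
    where
    interchange : ∀ k a b → k * a * (k * b) ≡ k * k * (a * b)
    interchange = solve-∀

  private
    χ-!^2q : ∀ q → χ (+ ((3 ℕ.+ n) !)) ^ (q ℕ.+ q) ≡ 1ℤ
    χ-!^2q q = trans (^-double A q) (trans (sym (*-^ A A q))
      (trans (cong (_^ q) (χ*χ (!-≋̸0 3+n<p))) (ℤP.^-zeroˡ q)))
      where A = χ (+ ((3 ℕ.+ n) !))

    -- (m - 1)!! divides m!, which is a unit since m < p.
    !!-≋̸0 : ¬ (+ ((1 ℕ.+ n) !!) ≋ 0ℤ)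
    !!-≋̸0 !!≋0 = !-≋̸0 {2 ℕ.+ n} (ℕP.<-trans (ℕP.n<1+n _) 3+n<p) (begin
      + ((2 ℕ.+ n) !)                         ≡⟨ cong +_ (n!≡n!!*[n-1]!! (suc n)) ⟩
      + ((2 ℕ.+ n) !! ℕ.* (1 ℕ.+ n) !!)       ≡⟨ ℤP.pos-* ((2 ℕ.+ n) !!) ((1 ℕ.+ n) !!) ⟩
      + ((2 ℕ.+ n) !!) * + ((1 ℕ.+ n) !!)     ≈⟨ *-congˡ (+ ((2 ℕ.+ n) !!)) !!≋0 ⟩
      + ((2 ℕ.+ n) !!) * 0ℤ                   ≡⟨ ℤP.*-zeroʳ (+ ((2 ℕ.+ n) !!)) ⟩
      0ℤ                                      ∎)
      where open ≋-Reasoning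

  -- Here `g` is odd, so one factor (m + 1)! = (m + 1) m!! (m - 1)!! is left over, and its (m - 1)!!
  -- cancels against the other one.
  χ-pfaffian-odd : ∀ r → suc g ≡ r ℕ.+ r →
    χ pfaffian ≡ χ ((+ k - 1ℤ) * (+ 2 * + k - 1ℤ)) * χ (+ ((2 ℕ.+ n) !!))
  χ-pfaffian-odd r 1+g≡2r = begin
    χ pfaffian
      ≡⟨ χ-pfaffian ⟩
    χ (+ (4 ℕ.+ n)) * (A ^ g * D)
      ≡⟨ cong (λ z → χ (+ (4 ℕ.+ n)) * (z * D)) A^g≡A ⟩
    χ (+ (4 ℕ.+ n)) * (A * D)
      ≡⟨ cong (λ z → χ (+ (4 ℕ.+ n)) * (z * D)) (trans (χ-ℕ* (3 ℕ.+ n) ((2 ℕ.+ n) !))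
           (cong (χ (+ (3 ℕ.+ n)) *_) (trans (cong (λ z → χ (+ z)) (n!≡n!!*[n-1]!! (suc n)))
             (χ-ℕ* ((2 ℕ.+ n) !!) ((1 ℕ.+ n) !!))))) ⟩
    χ (+ (4 ℕ.+ n)) * (χ (+ (3 ℕ.+ n)) * (E * D) * D)
      ≡⟨ regroup (χ (+ (4 ℕ.+ n))) (χ (+ (3 ℕ.+ n))) E D ⟩
    χ (+ (3 ℕ.+ n)) * χ (+ (4 ℕ.+ n)) * E * (D * D)
      ≡⟨ cong₂ (λ u v → u * E * v) (sym (trans
           (χ-cong (*-cong (≋-sym k[3+n]≋k-1) (≋-sym k[4+n]≋2k-1)))
           (χ-k* (+ (3 ℕ.+ n)) (+ (4 ℕ.+ n))))) (χ*χ !!-≋̸0) ⟩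
    χ ((+ k - 1ℤ) * (+ 2 * + k - 1ℤ)) * E * 1ℤ
      ≡⟨ ℤP.*-identityʳ (χ ((+ k - 1ℤ) * (+ 2 * + k - 1ℤ)) * E) ⟩
    χ ((+ k - 1ℤ) * (+ 2 * + k - 1ℤ)) * E ∎
    where
    open ≡-Reasoning
    A = χ (+ ((3 ℕ.+ n) !))
    D = χ (+ ((1 ℕ.+ n) !!))
    E = χ (+ ((2 ℕ.+ n) !!))
    regroup : ∀ a b e d → a * (b * (e * d) * d) ≡ b * a * e * (d * d)
    regroup = solve-∀
    A^g≡A : A ^ g ≡ A
    A^g≡A = begin
      A ^ g              ≡⟨ ℤP.*-identityˡ (A ^ g) ⟨
      -- Inserting `A * A` raises the exponent to `suc g`, which is even.
      1ℤ * A ^ g         ≡⟨ cong (_* A ^ g) (χ*χ (!-≋̸0 3+n<p)) ⟨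
      A * A * A ^ g      ≡⟨ ℤP.*-assoc A A (A ^ g) ⟩
      A * A ^ suc g      ≡⟨ cong (A *_) (trans (cong (A ^_) 1+g≡2r) (χ-!^2q r)) ⟩
      A * 1ℤ             ≡⟨ ℤP.*-identityʳ A ⟩
      A                  ∎

  -- With `g` even the powers of (m + 1)! disappear. The symbol of m + 2 is that of k · k(m + 2),
  -- and k(m + 2) ≡ 2k - 1.
  χ-pfaffian-even : ∀ r → g ≡ r ℕ.+ r →
    χ pfaffian ≡ χ (+ k * (+ 2 * + k - 1ℤ)) * χ (+ ((1 ℕ.+ n) !!))
  χ-pfaffian-even r g≡2r = begin
    χ pfaffian
      ≡⟨ χ-pfaffian ⟩
    χ (+ (4 ℕ.+ n)) * (A ^ g * D)
      ≡⟨ cong (λ z → χ (+ (4 ℕ.+ n)) * (z * D)) (trans (cong (A ^_) g≡2r) (χ-!^2q r)) ⟩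
    χ (+ (4 ℕ.+ n)) * (1ℤ * D)
      ≡⟨ cong (χ (+ (4 ℕ.+ n)) *_) (ℤP.*-identityˡ D) ⟩
    χ (+ (4 ℕ.+ n)) * D
      ≡⟨ cong (_* D) (begin
           χ (+ k * (+ 2 * + k - 1ℤ))           ≡⟨ χ-cong (*-congˡ (+ k) k[4+n]≋2k-1) ⟨
           χ (+ k * (+ k * + (4 ℕ.+ n)))        ≡⟨ cong (λ z → χ (z * (+ k * + (4 ℕ.+ n)))) (ℤP.*-identityʳ (+ k)) ⟨
           χ (+ k * 1ℤ * (+ k * + (4 ℕ.+ n)))   ≡⟨ χ-k* 1ℤ (+ (4 ℕ.+ n)) ⟩
           χ 1ℤ * χ (+ (4 ℕ.+ n))               ≡⟨ cong (_* χ (+ (4 ℕ.+ n))) χ-1 ⟩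
           1ℤ * χ (+ (4 ℕ.+ n))                 ≡⟨ ℤP.*-identityˡ (χ (+ (4 ℕ.+ n))) ⟩
           χ (+ (4 ℕ.+ n))                      ∎) ⟨
    χ (+ k * (+ 2 * + k - 1ℤ)) * D ∎
    where
    open ≡-Reasoning
    A = χ (+ ((3 ℕ.+ n) !))
    D = χ (+ ((1 ℕ.+ n) !!))

  -- Now m = 2: the product of binomials is empty, and m + 2 = 4 is a square.
  χ-pfaffian-one : g ≡ 0 → χ pfaffian ≡ 1ℤ
  χ-pfaffian-one g≡0 = begin
    χ pfaffian                     ≡⟨ cong (λ g → χ (+ (4 ℕ.+ (g ℕ.+ g)) * ∏< g coefficient)) g≡0 ⟩
    χ (+ 4)                        ≡⟨ χ-square 4≋̸0 (+ 2 , ≋-refl) ⟩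
    1ℤ                             ∎
    where
    open ≡-Reasoning
    4≋̸0 : ¬ (+ 4 ≋ 0ℤ)
    4≋̸0 = 0<a<n⇒≋̸0 (s≤s z≤n) (ℕP.≤-<-trans (ℕP.m≤m+n 4 n) 4+n<p)

-- From congruences for p to the parity of m/2

congruent⇒∣∸ : ∀ {n a b} → + a ≡ + b [mod n ] → b ≤ a → n ∣ a ∸ b
congruent⇒∣∸ {n} {a} {b} d b≤a = ℤ∣.∣⇒∣ᵤ (subst (+ n ℤ∣.∣_)
  (trans (ℤP.[+m]-[+n]≡m⊖n a b) (ℤP.⊖-≥ b≤a)) d)

-- Since p - 1 is (g + 1) · 2k and p - (2k + 1) is g · 2k, a congruence modulo 4k fixes the parity
-- of g + 1 or of g.
halve : ∀ k .{{_ : NonZero k}} a → 4 ℕ.* k ∣ a ℕ.* (2 ℕ.* k) → ∃ λ r → a ≡ r ℕ.+ r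
halve k a (ℕ∣.divides r eq) = r , ℕP.*-cancelʳ-≡ a (r ℕ.+ r) (2 ℕ.* k) {{ℕP.m*n≢0 2 k}}
  (trans eq (double r k))
  where
  double : ∀ r k → r ℕ.* (4 ℕ.* k) ≡ (r ℕ.+ r) ℕ.* (2 ℕ.* k)
  double = ℕSolver.solve-∀

module _ (p k g : ℕ) .{{_ : NonZero k}} (p-prime : Prime p) (2≤k : 2 ≤ k)
  (p≡ : p ≡ suc (suc g ℕ.* (2 ℕ.* k))) where

  private
    2k[1+g] : ∀ g k → suc g ℕ.* (2 ℕ.* k) ≡ k ℕ.* suc g ℕ.+ k ℕ.* suc g
    2k[1+g] = ℕSolver.solve-∀

  open SquareRoot p p-prime k g 2≤k (trans p≡ (cong suc (2k[1+g] g k))) using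
    (h; χ; χ≡legendre; pfaffian; χ-sqrt; χ-pfaffian-odd; χ-pfaffian-even; χ-pfaffian-one)

  -- `m` is a variable with an equation because the type of `α` mentions `(p ∸ 1) / k`, which equals
  -- 2 + 2g only propositionally.
  legendre-sqrt : ∀ {m} → m ≡ 2 ℕ.+ (g ℕ.+ g) →
    (α : Fin m → ℤ) → RepresentsPowerResidues k p α →
    (s : ℤ) → IsSqrt s (S (1 ℕ.+ m) -1ℤ α) →
    (+ p ≡ 1ℤ [mod 4 ℕ.* k ] →
      legendre s p
        ≡ legendre ((+ k - 1ℤ) * (+ 2 * + k - 1ℤ)) p * legendre (+ (m !!)) p * legendre (T α) p)
    ×
    (2 ∣ k → + p ≡ + 2 * + k + 1ℤ [mod 4 ℕ.* k ] →
      (p ≡ 2 ℕ.* k ℕ.+ 1 → legendre s p ≡ legendre (T α) p)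
      ×
      (p ≢ 2 ℕ.* k ℕ.+ 1 →
        legendre s p
          ≡ legendre (+ k * (+ 2 * + k - 1ℤ)) p * legendre (+ ((m ∸ 1) !!)) p * legendre (T α) p))
  legendre-sqrt refl α representation s s²≡S = 4k-case , 2k+1-case
    where
    evaluate : ∀ q → h ≡ q ℕ.+ q → ∀ a b → χ pfaffian ≡ χ a * χ b →
               legendre s p ≡ legendre a p * legendre b p * legendre (T α) p
    evaluate q h≡2q a b eq = trans (sym (χ≡legendre s))
      (trans (χ-sqrt α representation q h≡2q s s²≡S)
      (trans (cong (_* χ (T α)) eq)
        (cong₂ _*_ (cong₂ _*_ (χ≡legendre a) (χ≡legendre b)) (χ≡legendre (T α)))))

    4k-case : + p ≡ 1ℤ [mod 4 ℕ.* k ] → _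
    -- `h` is `k` times `suc g`, and in this case `suc g` is the even factor.
    4k-case p≡1 = evaluate (k ℕ.* proj₁ half)
      (trans (cong (k ℕ.*_) (proj₂ half)) (ℕP.*-distribˡ-+ k (proj₁ half) (proj₁ half)))
      ((+ k - 1ℤ) * (+ 2 * + k - 1ℤ)) (+ ((2 ℕ.+ (g ℕ.+ g)) !!)) (χ-pfaffian-odd (proj₁ half) (proj₂ half))
      where
      half : ∃ λ r → suc g ≡ r ℕ.+ r
      half = halve k (suc g) (subst (4 ℕ.* k ∣_) (cong (_∸ 1) p≡)
        (congruent⇒∣∸ {a = p} p≡1 (subst (1 ≤_) (sym p≡) (s≤s z≤n))))

    p≡2k+1+ : p ≡ 2 ℕ.* k ℕ.+ 1 ℕ.+ g ℕ.* (2 ℕ.* k)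
    p≡2k+1+ = trans p≡ (expand g k)
      where
      expand : ∀ g k → suc (suc g ℕ.* (2 ℕ.* k)) ≡ 2 ℕ.* k ℕ.+ 1 ℕ.+ g ℕ.* (2 ℕ.* k)
      expand = ℕSolver.solve-∀

    p∸[2k+1] : p ∸ (2 ℕ.* k ℕ.+ 1) ≡ g ℕ.* (2 ℕ.* k)
    p∸[2k+1] = trans (cong (_∸ (2 ℕ.* k ℕ.+ 1)) p≡2k+1+) (ℕP.m+n∸m≡n (2 ℕ.* k ℕ.+ 1) (g ℕ.* (2 ℕ.* k)))

    2k+1-case : 2 ∣ k → + p ≡ + 2 * + k + 1ℤ [mod 4 ℕ.* k ] → _
    2k+1-case (ℕ∣.divides t k≡t*2) p≡2k+1 =
        -- In both subcases `h` is even because `k` is `t * 2`, so half of it is `t * suc g`.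
        (λ p≡2k+1′ → trans (sym (χ≡legendre s)) (trans (χ-sqrt α representation (t ℕ.* suc g) h-even s s²≡S)
          (trans (cong (_* χ (T α)) (χ-pfaffian-one (g≡0 p≡2k+1′)))
          (trans (ℤP.*-identityˡ (χ (T α))) (χ≡legendre (T α))))))
      , (λ _ → evaluate (t ℕ.* suc g) h-even (+ k * (+ 2 * + k - 1ℤ)) (+ ((1 ℕ.+ (g ℕ.+ g)) !!)) g-even)
      where
      h-even : h ≡ t ℕ.* suc g ℕ.+ t ℕ.* suc g
      h-even = trans (cong (ℕ._* suc g) k≡t*2) (double t g)
        where
        double : ∀ t g → t ℕ.* 2 ℕ.* suc g ≡ t ℕ.* suc g ℕ.+ t ℕ.* suc g
        double = ℕSolver.solve-∀
      g≡0 : p ≡ 2 ℕ.* k ℕ.+ 1 → g ≡ 0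
      g≡0 p≡2k+1′ = ℕP.m*n≡0⇒m≡0 g (2 ℕ.* k) {{ℕP.m*n≢0 2 k}} (trans (sym p∸[2k+1])
        (trans (cong (_∸ (2 ℕ.* k ℕ.+ 1)) p≡2k+1′) (ℕP.n∸n≡0 (2 ℕ.* k ℕ.+ 1))))
      g-even : χ pfaffian ≡ χ (+ k * (+ 2 * + k - 1ℤ)) * χ (+ ((1 ℕ.+ (g ℕ.+ g)) !!))
      g-even = χ-pfaffian-even (proj₁ half) (proj₂ half)
        where
        half : ∃ λ r → g ≡ r ℕ.+ r
        half = halve k g (subst (4 ℕ.* k ∣_) p∸[2k+1]
          (congruent⇒∣∸ {a = p} {2 ℕ.* k ℕ.+ 1}
            (subst (λ z → + p ≡ z + 1ℤ [mod 4 ℕ.* k ]) (sym (ℤP.pos-* 2 k)) p≡2k+1)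
            (subst (2 ℕ.* k ℕ.+ 1 ≤_) (sym p≡2k+1+) (ℕP.m≤m+n (2 ℕ.* k ℕ.+ 1) (g ℕ.* (2 ℕ.* k))))))

theorem1p9 : (p k : ℕ) .{{_ : NonZero k}} →
    Prime p → ¬ (2 ∣ p) →
    2 ≤ k → k ≤ (p ∸ 1) / 2 →
    + p ≡ 1ℤ [mod 2 ℕ.* k ] →
    (α : Fin ((p ∸ 1) / k) → ℤ) → RepresentsPowerResidues k p α →
    (s : ℤ) → IsSqrt s (S (1 ℕ.+ (p ∸ 1) / k) -1ℤ α) →
    (+ p ≡ 1ℤ [mod 4 ℕ.* k ] →
    legendre s p
    ≡ legendre ((+ k - 1ℤ) * (+ 2 * + k - 1ℤ)) p
    * legendre (+ (((p ∸ 1) / k) !!)) p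
    * legendre (T α) p)
    ×
    (2 ∣ k → + p ≡ + 2 * + k + 1ℤ [mod 4 ℕ.* k ] →
    (p ≡ 2 ℕ.* k ℕ.+ 1 →
    legendre s p ≡ legendre (T α) p)
    ×
    (p ≢ 2 ℕ.* k ℕ.+ 1 →
    legendre s p
    ≡ legendre (+ k * (+ 2 * + k - 1ℤ)) p
    * legendre (+ (((p ∸ 1) / k ∸ 1) !!)) p
    * legendre (T α) p))
theorem1p9 p k p-prime _ 2≤k k≤[p-1]/2 p≡1 = by-quotient
  (congruent⇒∣∸ {a = p} p≡1 (ℕ.>-nonZero⁻¹ p {{prime⇒nonZero p-prime}}))
  where
  double : ∀ g k → suc g ℕ.* (2 ℕ.* k) ≡ (2 ℕ.+ (g ℕ.+ g)) ℕ.* k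
  double = ℕSolver.solve-∀
  by-quotient : 2 ℕ.* k ∣ p ∸ 1 → _
  -- A zero quotient means p - 1 = 0, and then k ≤ (p - 1)/2 gives k ≤ 0.
  by-quotient (ℕ∣.divides zero p∸1≡0) = ⊥-elim (ℕP.<⇒≱ (ℕP.≤-trans (s≤s z≤n) 2≤k)
    (subst (λ z → k ≤ z / 2) p∸1≡0 k≤[p-1]/2))
  by-quotient (ℕ∣.divides (suc g) p∸1≡) = legendre-sqrt p k g p-prime 2≤k
    (trans (sym (ℕP.suc-pred p {{prime⇒nonZero p-prime}})) (cong suc p∸1≡))
    (trans (cong (_/ k) (trans p∸1≡ (double g k))) (m*n/n≡m (2 ℕ.+ (g ℕ.+ g)) k))
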